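{- Let $n$ be even. For every coloring $C$ of $E(K_n)$ with colors $\{1,\dots,n-1\}$ that is not a one-factorization, there is a coloring $C'$ adjacent to $C$ in $\mathcal D_n$ with $\Psi(C')<\Psi(C)$, and such a $C'$ can be found in time polynomial in $n$. Consequently, from every starting coloring there is a walk in $\mathcal D_n$ along which $\Psi$ strictly decreases at every step and which reaches a one-factorization after $O(n^3)$ steps.
   Context: $K_n$ is the complete graph on vertex set $[n]$. A coloring is any map $C:E(K_n)\to\{1,\dots,n-1\}$, not necessarily proper. A one-factorization is a proper coloring (any two edges sharing a vertex receive different colors). For a coloring $C$, vertex $u$ and color $\mu$, let $a_{u,\mu}$ be the number of $\mu$-colored edges incident with $u$, and $\Psi(C)=\sum_{u,\mu}\binom{a_{u,\mu}}{2}$ (the number of pairs of incident equally colored edges). The graph $\mathcal D_n$ has all such colorings as vertices; two distinct colorings $C,C'$ are adjacent iff there are two vertices $u,v\in[n]$ such that every edge on which $C$ and $C'$ differ is incident with $u$ or with $v$. -}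

module Defs where

open import Data.Nat using (ℕ; zero; suc; _+_; _∸_; _<_)
open import Data.Nat.Combinatorics using () renaming (_C_ to _choose_)
open import Data.Fin using (Fin; toℕ)
import Data.Fin as Fin
import Data.Fin.Properties as Fin
open import Data.List using (List; []; _∷_; allFin; cartesianProduct; filter; length; map; mapMaybe)
open import Data.List.Membership.Propositional using (_∈_)
open import Data.List.Relation.Unary.All using (All; []; _∷_)
import Data.List.Relation.Unary.All as All
open import Data.Maybe using (Maybe; just; nothing)
open import Data.Nat.ListAction using (sum)
open import Data.Product using (∃-syntax; _×_; _,_; proj₁; proj₂)
open import Data.Sum using (_⊎_)
open import Relation.Binary.PropositionalEquality using (_≡_; _≢_)
open import Relation.Nullary using (Dec; yes; no)
open import Relation.Nullary.Decidable using (_⊎-dec_; _×-dec_)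

------------------------------------------------------------------------
-- Colorings of the complete graph

-- An edge is a two-element set of vertices, stored in increasing order.
record Edge (n : ℕ) : Set where
  constructor edge
  field
    lo hi  : Fin n
    .lo<hi : lo Fin.< hi

open Edge public

mkEdge : ∀ {n} → Fin n × Fin n → Maybe (Edge n)
mkEdge (u , v) with u Fin.<? v
... | yes u<v = just (edge u v u<v)
... | no  _   = nothing

edges : ∀ n → List (Edge n)
edges n = mapMaybe mkEdge (cartesianProduct (allFin n) (allFin n))

Incident : ∀ {n} → Fin n → Edge n → Set
Incident u e = u ≡ lo e ⊎ u ≡ hi e

incident? : ∀ {n} (u : Fin n) (e : Edge n) → Dec (Incident u e)
incident? u e = (u Fin.≟ lo e) ⊎-dec (u Fin.≟ hi e)

Color : ℕ → Set
Color n = Fin (n ∸ 1)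

Coloring : ℕ → Set
Coloring n = Edge n → Color n

OneFactorization : ∀ {n} → Coloring n → Set
OneFactorization C =
  ∀ e f → e ≢ f → (∃[ u ] Incident u e × Incident u f) → C e ≢ C f

multiplicity : ∀ {n} → Coloring n → Fin n → Color n → ℕ
multiplicity {n} C u μ =
  length (filter (λ e → incident? u e ×-dec (C e Fin.≟ μ)) (edges n))

Ψ : ∀ {n} → Coloring n → ℕ
Ψ {n} C =
  sum (map (λ u → sum (map (λ μ → multiplicity C u μ choose 2) (allFin (n ∸ 1))))
           (allFin n))

-- Colorings are functions, so being distinct means differing on some edge.
Adjacent : ∀ {n} → Coloring n → Coloring n → Set
Adjacent C C′ =
  (∃[ e ] C e ≢ C′ e) ×
  (∃[ u ] ∃[ v ] u ≢ v × (∀ e → C e ≢ C′ e → Incident u e ⊎ Incident v e))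

data DescendingWalk {n} : Coloring n → Coloring n → ℕ → Set where
  stop : ∀ {C} → DescendingWalk C C 0
  step : ∀ {C C′ D ℓ} → Adjacent C C′ → Ψ C′ < Ψ C →
         DescendingWalk C′ D ℓ → DescendingWalk C D (suc ℓ)

------------------------------------------------------------------------
-- A model of computation

-- Programs are closed syntax in a first-order call-by-value language, and
-- every evaluation of a syntax node costs one unit.  Numbers are unary and no
-- arithmetic is primitive, so with values represented by pointers each
-- unit takes a bounded number of pointer-machine operations.  Conversely,
-- bounded recursion suffices to run a Turing machine for polynomially many
-- steps.  Polynomial cost is therefore polynomial time in the usual sense.

infixr 6 _⊗_

data Ty : Set where
  nat  : Ty
  _⊗_  : Ty → Ty → Ty
  list : Ty → Ty

Val : Ty → Set
Val nat      = ℕ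
Val (A ⊗ B)  = Val A × Val B
Val (list A) = List (Val A)

Ctx : Set
Ctx = List Ty

Env : Ctx → Set
Env = All Val

data Tm : Ctx → Ty → Set where
  var   : ∀ {Γ A} → A ∈ Γ → Tm Γ A
  let′  : ∀ {Γ A B} → Tm Γ A → Tm (A ∷ Γ) B → Tm Γ B
  -- Application of a closed procedure of one argument.
  call  : ∀ {Γ A B} → Tm (A ∷ []) B → Tm Γ A → Tm Γ B
  zero′ : ∀ {Γ} → Tm Γ nat
  suc′  : ∀ {Γ} → Tm Γ nat → Tm Γ nat
  caseℕ : ∀ {Γ B} → Tm Γ nat → Tm Γ B → Tm (nat ∷ Γ) B → Tm Γ B
  -- The step is given the recursive result and the predecessor.
  recℕ  : ∀ {Γ B} → Tm Γ nat → Tm Γ B → Tm (B ∷ nat ∷ Γ) B → Tm Γ B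
  pair  : ∀ {Γ A B} → Tm Γ A → Tm Γ B → Tm Γ (A ⊗ B)
  fst   : ∀ {Γ A B} → Tm Γ (A ⊗ B) → Tm Γ A
  snd   : ∀ {Γ A B} → Tm Γ (A ⊗ B) → Tm Γ B
  nil   : ∀ {Γ A} → Tm Γ (list A)
  cons  : ∀ {Γ A} → Tm Γ A → Tm Γ (list A) → Tm Γ (list A)
  caseL : ∀ {Γ A B} → Tm Γ (list A) → Tm Γ B → Tm (A ∷ list A ∷ Γ) B → Tm Γ B
  -- The step is given the recursive result, the head and the tail.
  recL  : ∀ {Γ A B} → Tm Γ (list A) → Tm Γ B → Tm (B ∷ A ∷ list A ∷ Γ) B → Tm Γ B

primℕ : ∀ {B : Set} → B → (B → ℕ → B) → ℕ → B
primℕ z s zero    = z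
primℕ z s (suc n) = s (primℕ z s n) n

primL : ∀ {A B : Set} → B → (B → A → List A → B) → List A → B
primL z s []       = z
primL z s (x ∷ xs) = s (primL z s xs) x xs

mutual
  eval : ∀ {Γ A} → Tm Γ A → Env Γ → Val A
  eval (var x)       ρ = All.lookup ρ x
  eval (let′ t b)    ρ = eval b (eval t ρ ∷ ρ)
  eval (call b t)    ρ = eval b (eval t ρ ∷ [])
  eval zero′         ρ = zero
  eval (suc′ t)      ρ = suc (eval t ρ)
  eval (caseℕ t z s) ρ = evalCaseℕ z s ρ (eval t ρ)
  eval (recℕ t z s)  ρ = primℕ (eval z ρ) (λ r n → eval s (r ∷ n ∷ ρ)) (eval t ρ)
  eval (pair t u)    ρ = eval t ρ , eval u ρ
  eval (fst t)       ρ = proj₁ (eval t ρ)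
  eval (snd t)       ρ = proj₂ (eval t ρ)
  eval nil           ρ = []
  eval (cons t u)    ρ = eval t ρ ∷ eval u ρ
  eval (caseL t z s) ρ = evalCaseL z s ρ (eval t ρ)
  eval (recL t z s)  ρ = primL (eval z ρ) (λ r x xs → eval s (r ∷ x ∷ xs ∷ ρ)) (eval t ρ)

  evalCaseℕ : ∀ {Γ B} → Tm Γ B → Tm (nat ∷ Γ) B → Env Γ → ℕ → Val B
  evalCaseℕ z s ρ zero    = eval z ρ
  evalCaseℕ z s ρ (suc n) = eval s (n ∷ ρ)

  evalCaseL : ∀ {Γ A B} → Tm Γ B → Tm (A ∷ list A ∷ Γ) B → Env Γ → List (Val A) → Val B
  evalCaseL z s ρ []       = eval z ρ
  evalCaseL z s ρ (x ∷ xs) = eval s (x ∷ xs ∷ ρ)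

mutual
  cost : ∀ {Γ A} → Tm Γ A → Env Γ → ℕ
  cost (var x)       ρ = 1
  cost (let′ t b)    ρ = suc (cost t ρ + cost b (eval t ρ ∷ ρ))
  cost (call b t)    ρ = suc (cost t ρ + cost b (eval t ρ ∷ []))
  cost zero′         ρ = 1
  cost (suc′ t)      ρ = suc (cost t ρ)
  cost (caseℕ t z s) ρ = suc (cost t ρ + costCaseℕ z s ρ (eval t ρ))
  cost (recℕ t z s)  ρ = suc (cost t ρ + costRecℕ z s ρ (eval t ρ))
  cost (pair t u)    ρ = suc (cost t ρ + cost u ρ)
  cost (fst t)       ρ = suc (cost t ρ)
  cost (snd t)       ρ = suc (cost t ρ)
  cost nil           ρ = 1
  cost (cons t u)    ρ = suc (cost t ρ + cost u ρ)
  cost (caseL t z s) ρ = suc (cost t ρ + costCaseL z s ρ (eval t ρ))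
  cost (recL t z s)  ρ = suc (cost t ρ + costRecL z s ρ (eval t ρ))

  costCaseℕ : ∀ {Γ B} → Tm Γ B → Tm (nat ∷ Γ) B → Env Γ → ℕ → ℕ
  costCaseℕ z s ρ zero    = cost z ρ
  costCaseℕ z s ρ (suc n) = cost s (n ∷ ρ)

  costCaseL : ∀ {Γ A B} → Tm Γ B → Tm (A ∷ list A ∷ Γ) B → Env Γ → List (Val A) → ℕ
  costCaseL z s ρ []       = cost z ρ
  costCaseL z s ρ (x ∷ xs) = cost s (x ∷ xs ∷ ρ)

  costRecℕ : ∀ {Γ B} → Tm Γ B → Tm (B ∷ nat ∷ Γ) B → Env Γ → ℕ → ℕ
  costRecℕ z s ρ zero    = cost z ρ
  costRecℕ z s ρ (suc n) =
    costRecℕ z s ρ n +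
    cost s (primℕ (eval z ρ) (λ r m → eval s (r ∷ m ∷ ρ)) n ∷ n ∷ ρ)

  costRecL : ∀ {Γ A B} → Tm Γ B → Tm (B ∷ A ∷ list A ∷ Γ) B → Env Γ → List (Val A) → ℕ
  costRecL z s ρ []       = cost z ρ
  costRecL z s ρ (x ∷ xs) =
    costRecL z s ρ xs +
    cost s (primL (eval z ρ) (λ r y ys → eval s (r ∷ y ∷ ys ∷ ρ)) xs ∷ x ∷ xs ∷ ρ)

Program : Ty → Ty → Set
Program A B = Tm (A ∷ []) B

run : ∀ {A B} → Program A B → Val A → Val B
run p x = eval p (x ∷ [])

time : ∀ {A B} → Program A B → Val A → ℕ
time p x = cost p (x ∷ [])

-- A coloring is presented to a program as n together with the list of all
-- triples (endpoint, endpoint, color); its size is polynomial in n.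
coloringTy : Ty
coloringTy = nat ⊗ list (nat ⊗ nat ⊗ nat)

encode : ∀ {n} → Coloring n → Val coloringTy
encode {n} C = n , map (λ e → toℕ (lo e) , toℕ (hi e) , toℕ (C e)) (edges n)

-- For a vertex u and a colour μ let a(u,μ) be the number of μ-coloured edges at u.  Exchanging
-- the colours of the edges wx and ux changes nothing at x, so the colours at w and u can be
-- redistributed along any set F of common neighbours.  Suppose that a(w,ν) ≥ a(u,ν) + 2.  Every x
-- is an arc from the colour of wx to the colour of ux; a walk along unused arcs starting at ν gets
-- stuck at a colour κ with a(w,κ) < a(u,κ), and exchanging along it moves one ν from w to u and one
-- κ back, which decreases Ψ.
--
-- If no two vertices differ by 2 in any colour and v has a repeated colour μ, then v misses some
-- colour ν.  Recolour an edge vw from μ to ν.  If w also missed ν, then Ψ decreases at once.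
-- Otherwise Ψ does not increase and w now has two ν's, while n being even forces a second vertex
-- u ≠ v to miss ν: rebalancing w and u decreases Ψ.  All the edges changed meet {w,u}.
--
-- Both cases are instances of one family of candidates indexed by (v,w,u,ν), and a program can afford
-- to try them all: every recursion has at most n³ steps.  The same bound Ψ ≤ n³ limits the walk.

module Submission where

open import Algebra.Properties.CommutativeSemigroup using (interchange)
open import Data.Nat
open import Data.Nat.Properties
open import Data.Nat.Combinatorics using (nC1≡n; nCk+nC[k+1]≡[n+1]C[k+1]) renaming (_C_ to _choose_)
open import Data.Nat.Divisibility using (_∣_; divides; ∣m∣n⇒∣m+n; ∣m+n∣m⇒∣n; ∣1⇒≡1)
open import Data.Nat.ListAction using (sum)
open import Data.Nat.ListAction.Properties using (sum-++)
open import Data.Nat.Tactic.RingSolver using (solve-∀)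
open import Data.Fin using (Fin; toℕ; fromℕ<)
import Data.Fin as Fin
import Data.Fin.Properties as Fin
open import Data.Maybe using (just; nothing)
import Data.Maybe.Relation.Unary.Any as Maybe
open import Data.List using (List; []; _∷_; _++_; length; map; filter; mapMaybe; tabulate; cartesianProduct; allFin)
open import Data.List.Properties using (map-++; map-∘; map-cong; length-++; length-map; length-mapMaybe; length-tabulate)
open import Data.List.Membership.Propositional using (_∈_; _∉_; find)
open import Data.List.Membership.Propositional.Properties using (∈-cartesianProduct⁺; ∈-allFin)
open import Data.List.Relation.Unary.Any using (here; there; any?)
import Data.List.Relation.Unary.Any as Any
import Data.List.Relation.Unary.Any.Properties as Any
open import Data.List.Relation.Unary.All using (All; []; _∷_)
import Data.List.Relation.Unary.All as All
import Data.List.Relation.Unary.All.Properties as All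
open import Data.Product using (∃-syntax; _×_; _,_; proj₁; proj₂; map₂)
open import Data.Sum using (_⊎_; inj₁; inj₂; reduce) renaming (swap to ⊎-swap)
open import Data.Unit using (⊤)
open import Function using (_∘_; id)
open import Relation.Binary.PropositionalEquality
open import Relation.Nullary using (¬_; Dec; yes; no; contradiction)
open import Relation.Nullary.Decidable using (¬?; recompute; decidable-stable; _×-dec_)
open import Defs

-- Why the walk cannot get stuck at a bad colour: it leaves every colour as often as it enters it,
-- except at its two ends, and once it is stuck every column in which row w has colour κ has been
-- used, apart from the column of u itself. The edge wu shows the same colour in both rows, so it
-- drops out of the comparison. If the walk had returned to ν, then w would have at most as many ν's
-- as u; hence it ends elsewhere, having entered κ once more than it left it. The time bound shapes
-- the rest. The language knows neither truth values nor edges nor arithmetic, so the mathematics is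
-- done on functions between numbers, with 0 and 1 as truth values and loops written as primitive
-- recursion; each program then computes the very function that the proofs discuss. As the text of a
-- program is fixed, its cost is polynomial as soon as all its recursions have polynomial length.
-- The largest bound is needed for the truncated subtraction that compares two values of Ψ, and this
-- is where n³ comes from.

private variable
  A : Set
  P Q : Set

-- Truth values as numbers

if : ℕ → A → A → A
if zero    t e = e
if (suc _) t e = t

-- Indexing by the number means that matching on a `Test` replaces this number by 1 or 0 in the goal
-- and hands over the evidence at the same time.
data Test (P : Set) : ℕ → Set where
  true  :   P → Test P 1
  false : ¬ P → Test P 0

_and_ _or_ : ℕ → ℕ → ℕ
i and j = if i j 0
i or  j = if i 1 j

and-test : ∀ {i j} → Test P i → Test Q j → Test (P × Q) (i and j)
and-test (true p)   (true q)   = true (p , q)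
and-test (true _)   (false ¬q) = false (¬q ∘ proj₂)
and-test (false ¬p) _          = false (¬p ∘ proj₁)

or-test : ∀ {i j} → Test P i → Test Q j → Test (P ⊎ Q) (i or j)
or-test (true p)   _          = true (inj₁ p)
or-test (false _)  (true q)   = true (inj₂ q)
or-test (false ¬p) (false ¬q) = false λ { (inj₁ p) → ¬p p ; (inj₂ q) → ¬q q }

test-map : (P → Q) → (Q → P) → ∀ {i} → Test P i → Test Q i
test-map f g (true p)   = true (f p)
test-map f g (false ¬p) = false (¬p ∘ g)

δ : ℕ → ℕ → ℕ
δ zero    zero    = 1
δ zero    (suc _) = 0
δ (suc _) zero    = 0
δ (suc i) (suc j) = δ i j

δ-test : ∀ i j → Test (i ≡ j) (δ i j)
δ-test zero    zero    = true refl
δ-test zero    (suc j) = false λ ()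
δ-test (suc i) zero    = false λ ()
δ-test (suc i) (suc j) = test-map (cong suc) suc-injective (δ-test i j)

δ-refl : ∀ i → δ i i ≡ 1
δ-refl zero    = refl
δ-refl (suc i) = δ-refl i

δ-≢ : ∀ {i j} → i ≢ j → δ i j ≡ 0
δ-≢ {i} {j} i≢j with δ i j | δ-test i j
... | _ | true i≡j = contradiction i≡j i≢j
... | _ | false _  = refl

δ≤1 : ∀ i j → δ i j ≤ 1
δ≤1 i j with δ i j | δ-test i j
... | _ | true  _ = ≤-refl
... | _ | false _ = z≤n

δ-sym : ∀ i j → δ i j ≡ δ j i
δ-sym zero    zero    = refl
δ-sym zero    (suc j) = refl
δ-sym (suc i) zero    = refl
δ-sym (suc i) (suc j) = δ-sym i j

test-unique : ∀ {P : Set} {i j} → Test P i → Test P j → i ≡ j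
test-unique (true _)   (true _)   = refl
test-unique (true p)   (false ¬p) = contradiction p ¬p
test-unique (false ¬p) (true p)   = contradiction p ¬p
test-unique (false _)  (false _)  = refl

-- Finite sums

∑ : ℕ → (ℕ → ℕ) → ℕ
∑ zero    f = 0
∑ (suc n) f = ∑ n f + f n

∑-cong : ∀ n {f g} → (∀ i → i < n → f i ≡ g i) → ∑ n f ≡ ∑ n g
∑-cong zero    eq = refl
∑-cong (suc n) eq = cong₂ _+_ (∑-cong n λ i i<n → eq i (m<n⇒m<1+n i<n)) (eq n ≤-refl)

∑-mono : ∀ n {f g} → (∀ i → i < n → f i ≤ g i) → ∑ n f ≤ ∑ n g
∑-mono zero    le = z≤n
∑-mono (suc n) le = +-mono-≤ (∑-mono n λ i i<n → le i (m<n⇒m<1+n i<n)) (le n ≤-refl)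

∑-distrib-+ : ∀ n f g → ∑ n (λ i → f i + g i) ≡ ∑ n f + ∑ n g
∑-distrib-+ zero    f g = refl
∑-distrib-+ (suc n) f g rewrite ∑-distrib-+ n f g =
  interchange +-commutativeSemigroup (∑ n f) (∑ n g) (f n) (g n)

∑-const : ∀ n k → ∑ n (λ _ → k) ≡ n * k
∑-const zero    k = refl
∑-const (suc n) k rewrite ∑-const n k = +-comm (n * k) k

∑-zero : ∀ n → ∑ n (λ _ → 0) ≡ 0
∑-zero n = trans (∑-const n 0) (*-zeroʳ n)

∑-swap : ∀ m n (f : ℕ → ℕ → ℕ) → ∑ m (λ i → ∑ n (f i)) ≡ ∑ n (λ j → ∑ m (λ i → f i j))
∑-swap zero    n f = sym (∑-zero n)
∑-swap (suc m) n f rewrite ∑-swap m n f =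
  sym (∑-distrib-+ n (λ j → ∑ m (λ i → f i j)) (f m))

∑-*ʳ : ∀ n f k → ∑ n (λ i → f i * k) ≡ ∑ n f * k
∑-*ʳ zero    f k = refl
∑-*ʳ (suc n) f k rewrite ∑-*ʳ n f k = sym (*-distribʳ-+ k (∑ n f) (f n))

∑-δ : ∀ n {j} (f : ℕ → ℕ) → j < n → ∑ n (λ i → δ i j * f i) ≡ f j
∑-δ (suc n) {j} f j<1+n with δ n j | δ-test n j
... | _ | true refl =
  trans (cong (_+ (f n + 0)) (trans (∑-cong n λ i i<n → cong (_* f i) (δ-≢ (<⇒≢ i<n))) (∑-zero n)))
        (+-identityʳ (f n))
... | _ | false n≢j =
  trans (+-identityʳ _) (∑-δ n f (≤∧≢⇒< (s≤s⁻¹ j<1+n) (n≢j ∘ sym)))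

∑-update : ∀ n {j f g} → j < n → (∀ i → i < n → i ≢ j → g i ≡ f i) →
           ∑ n g + f j ≡ ∑ n f + g j
∑-update n {j} {f} {g} j<n eq = begin
  ∑ n g + f j                        ≡⟨ cong (∑ n g +_) (∑-δ n f j<n) ⟨
  ∑ n g + ∑ n (λ i → δ i j * f i)    ≡⟨ ∑-distrib-+ n _ _ ⟨
  ∑ n (λ i → g i + δ i j * f i)      ≡⟨ ∑-cong n pointwise ⟩
  ∑ n (λ i → f i + δ i j * g i)      ≡⟨ ∑-distrib-+ n _ _ ⟩
  ∑ n f + ∑ n (λ i → δ i j * g i)    ≡⟨ cong (∑ n f +_) (∑-δ n g j<n) ⟩
  ∑ n f + g j                        ∎
  where
  open ≡-Reasoning
  pointwise : ∀ i → i < n → g i + δ i j * f i ≡ f i + δ i j * g i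
  pointwise i i<n with δ i j | δ-test i j
  ... | _ | true refl = swap (g i) (f i)
    where swap : ∀ a b → a + (b + 0) ≡ b + (a + 0)
          swap = solve-∀
  ... | _ | false i≢j = cong (_+ 0) (eq i i<n i≢j)

∑-update₂ : ∀ n {j k f g} → j < n → k < n → j ≢ k →
            (∀ i → i < n → i ≢ j → i ≢ k → g i ≡ f i) →
            ∑ n g + (f j + f k) ≡ ∑ n f + (g j + g k)
∑-update₂ n {j} {k} {f} {g} j<n k<n j≢k eq = begin
  ∑ n g + (f j + f k)                                          ≡⟨ add g f ⟨
  ∑ n (λ i → g i + (δ i j * f i + δ i k * f i))                ≡⟨ ∑-cong n pointwise ⟩
  ∑ n (λ i → f i + (δ i j * g i + δ i k * g i))                ≡⟨ add f g ⟩
  ∑ n f + (g j + g k)                                          ∎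
  where
  open ≡-Reasoning
  add : ∀ a b → ∑ n (λ i → a i + (δ i j * b i + δ i k * b i)) ≡ ∑ n a + (b j + b k)
  add a b = trans (∑-distrib-+ n a _)
    (cong (∑ n a +_) (trans (∑-distrib-+ n _ _) (cong₂ _+_ (∑-δ n b j<n) (∑-δ n b k<n))))
  swap : ∀ a b → a + (b + 0 + 0) ≡ b + (a + 0 + 0)
  swap = solve-∀
  pointwise : ∀ i → i < n → g i + (δ i j * f i + δ i k * f i) ≡ f i + (δ i j * g i + δ i k * g i)
  pointwise i i<n with δ i j | δ-test i j | δ i k | δ-test i k
  ... | _ | true refl | _ | true refl = contradiction refl j≢k
  ... | _ | true refl | _ | false _   = swap (g i) (f i)
  ... | _ | false _   | _ | true refl = swap₁ (g i) (f i)
    where swap₁ : ∀ a b → a + (b + 0) ≡ b + (a + 0)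
          swap₁ = solve-∀
  ... | _ | false i≢j | _ | false i≢k = cong (_+ 0) (eq i i<n i≢j i≢k)

term≤∑ : ∀ n {j} (f : ℕ → ℕ) → j < n → f j ≤ ∑ n f
term≤∑ (suc n) {j} f j<1+n with j ≟ n
... | yes refl = m≤n+m (f n) (∑ n f)
... | no  j≢n  = m≤n⇒m≤n+o (f n) (term≤∑ n f (≤∧≢⇒< (s≤s⁻¹ j<1+n) j≢n))

two-terms≤∑ : ∀ n {j k} (f : ℕ → ℕ) → j < n → k < n → j ≢ k → f j + f k ≤ ∑ n f
two-terms≤∑ n {j} {k} f j<n k<n j≢k = begin
  f j + f k                                     ≡⟨ cong₂ _+_ (∑-δ n f j<n) (∑-δ n f k<n) ⟨
  ∑ n (λ i → δ i j * f i) + ∑ n (λ i → δ i k * f i) ≡⟨ ∑-distrib-+ n _ _ ⟨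
  ∑ n (λ i → δ i j * f i + δ i k * f i)         ≤⟨ ∑-mono n (λ i _ → pointwise i) ⟩
  ∑ n f                                         ∎
  where
  open ≤-Reasoning
  pointwise : ∀ i → δ i j * f i + δ i k * f i ≤ f i
  pointwise i with δ i j | δ-test i j | δ i k | δ-test i k
  ... | _ | true refl | _ | true refl = contradiction refl j≢k
  ... | _ | true refl | _ | false _   = ≤-reflexive (trans (+-identityʳ _) (+-identityʳ _))
  ... | _ | false _   | _ | true refl = ≤-reflexive (+-identityʳ _)
  ... | _ | false _   | _ | false _   = z≤n

∑-positive : ∀ n f → 0 < ∑ n f → ∃[ i ] i < n × 0 < f i
∑-positive (suc n) f pos with f n in eq
... | suc k = n , ≤-refl , subst (0 <_) (sym eq) z<s
... | zero  with ∑-positive n f (subst (0 <_) (+-identityʳ _) pos)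
...   | i , i<n , 0<fi = i , m<n⇒m<1+n i<n , 0<fi

-- Enlarging the square by one adds a new row and a new column with equal sums, and a corner that is
-- 0.
∑-symmetric-even : ∀ n (f : ℕ → ℕ → ℕ) → (∀ i j → f i j ≡ f j i) → (∀ i → f i i ≡ 0) →
                   2 ∣ ∑ n (λ i → ∑ n (f i))
∑-symmetric-even zero    f f-sym f-diag = divides 0 refl
∑-symmetric-even (suc n) f f-sym f-diag =
  subst (2 ∣_) (sym split)
    (∣m∣n⇒∣m+n (∑-symmetric-even n f f-sym f-diag) (divides (∑ n (f n)) (double (∑ n (f n)))))
  where
  double : ∀ a → a + a ≡ a * 2
  double = solve-∀
  rearrange : ∀ a b → (a + b) + (b + 0) ≡ a + (b + b)
  rearrange = solve-∀
  split : ∑ (suc n) (λ i → ∑ (suc n) (f i)) ≡ ∑ n (λ i → ∑ n (f i)) + (∑ n (f n) + ∑ n (f n))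
  split = trans
    (cong₂ _+_ (trans (∑-distrib-+ n (λ i → ∑ n (f i)) (λ i → f i n))
                      (cong (∑ n (λ i → ∑ n (f i)) +_) (∑-cong n λ i _ → f-sym i n)))
               (cong (∑ n (f n) +_) (f-diag n)))
    (rearrange (∑ n (λ i → ∑ n (f i))) (∑ n (f n)))

-- The binomial coefficient k choose 2 in the form 0 + 1 + ... + (k - 1): one more edge of a colour
-- costs exactly the present count of that colour.
tri : ℕ → ℕ
tri zero    = 0
tri (suc k) = tri k + k

tri≤ : ∀ {k n} → k ≤ n → tri k ≤ k * n
tri≤ {zero}  _   = z≤n
tri≤ {suc k} {n} k<n = begin
  tri k + k  ≤⟨ +-mono-≤ (tri≤ (<⇒≤ k<n)) (<⇒≤ k<n) ⟩
  k * n + n  ≡⟨ +-comm (k * n) n ⟩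
  n + k * n  ∎
  where open ≤-Reasoning

-- Taking one unit from the count `f ν` saves `f ν - 1`, and giving it to the count `f κ` costs
-- `f κ`. The equation records this change with every subtraction moved to the other side.
∑-tri-transfer : ∀ m {ν κ} {f g : ℕ → ℕ} → ν < m → κ < m → ν ≢ κ →
                 (∀ μ → g μ + δ μ ν ≡ f μ + δ μ κ) →
                 ∑ m (tri ∘ g) + f ν ≡ ∑ m (tri ∘ f) + suc (f κ)
∑-tri-transfer m {ν} {κ} {f} {g} ν<m κ<m ν≢κ eq = begin
  ∑ m (tri ∘ g) + f ν                                       ≡⟨ cong (∑ m (tri ∘ g) +_) (∑-δ m f ν<m) ⟨
  ∑ m (tri ∘ g) + ∑ m (λ μ → δ μ ν * f μ)                   ≡⟨ ∑-distrib-+ m _ _ ⟨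
  ∑ m (λ μ → tri (g μ) + δ μ ν * f μ)                       ≡⟨ ∑-cong m (λ μ _ → pointwise μ) ⟩
  ∑ m (λ μ → tri (f μ) + (δ μ ν * 1 + δ μ κ * f μ))         ≡⟨ ∑-distrib-+ m _ _ ⟩
  ∑ m (tri ∘ f) + ∑ m (λ μ → δ μ ν * 1 + δ μ κ * f μ)       ≡⟨ cong (∑ m (tri ∘ f) +_) (∑-distrib-+ m _ _) ⟩
  ∑ m (tri ∘ f) + (∑ m (λ μ → δ μ ν * 1) + ∑ m (λ μ → δ μ κ * f μ))
    ≡⟨ cong (∑ m (tri ∘ f) +_) (cong₂ _+_ (∑-δ m (λ _ → 1) ν<m) (∑-δ m f κ<m)) ⟩
  ∑ m (tri ∘ f) + suc (f κ)                                 ∎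
  where
  open ≡-Reasoning
  lower : ∀ t k → t + (suc k + 0) ≡ t + k + 1
  lower = solve-∀
  pointwise : ∀ μ → tri (g μ) + δ μ ν * f μ ≡ tri (f μ) + (δ μ ν * 1 + δ μ κ * f μ)
  pointwise μ with δ μ ν | δ-test μ ν | δ μ κ | δ-test μ κ | eq μ
  ... | _ | true refl | _ | true refl | _ = contradiction refl ν≢κ
  ... | _ | true refl | _ | false _ | e
    rewrite trans (sym (+-identityʳ (f μ))) (trans (sym e) (+-comm (g μ) 1)) = lower (tri (g μ)) (g μ)
  ... | _ | false _ | _ | true refl | e
    rewrite trans (sym (+-identityʳ (g μ))) (trans e (+-comm (f μ) 1)) =
      trans (+-identityʳ _) (cong (tri (f μ) +_) (sym (+-identityʳ _)))
  ... | _ | false _ | _ | false _ | e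
    rewrite +-cancelʳ-≡ 0 (g μ) (f μ) e = refl

-- Colourings as matrices

-- The colour μ of an edge xy is stored as c x y = suc μ, and c x x = 0.
record EdgeColouring (n : ℕ) (c : ℕ → ℕ → ℕ) : Set where
  field
    symmetric : ∀ x y → c x y ≡ c y x
    diagonal  : ∀ x → c x x ≡ 0
    positive  : ∀ {x y} → x < n → y < n → x ≢ y → 0 < c x y
    range     : ∀ x y → c x y ≤ n ∸ 1

count : ℕ → (ℕ → ℕ) → ℕ → ℕ
count n r μ = ∑ n (λ x → δ (r x) μ)

rowΨ : ℕ → (ℕ → ℕ) → ℕ
rowΨ n r = ∑ (n ∸ 1) (λ μ → tri (count n r (suc μ)))

matrixΨ : ℕ → (ℕ → ℕ → ℕ) → ℕ
matrixΨ n c = ∑ n (λ u → rowΨ n (c u))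

count-cong : ∀ n r r′ → (∀ x → x < n → r x ≡ r′ x) → ∀ μ → count n r μ ≡ count n r′ μ
count-cong n r r′ eq μ = ∑-cong n λ x x<n → cong (λ k → δ k μ) (eq x x<n)

rowΨ-cong : ∀ n r r′ → (∀ μ → count n r μ ≡ count n r′ μ) → rowΨ n r ≡ rowΨ n r′
rowΨ-cong n r r′ eq = ∑-cong (n ∸ 1) λ μ _ → cong tri (eq (suc μ))

matrixΨ-cong : ∀ n {c c′} → (∀ x y → x < n → y < n → c x y ≡ c′ x y) → matrixΨ n c ≡ matrixΨ n c′
matrixΨ-cong n {c} {c′} eq =
  ∑-cong n λ u u<n → rowΨ-cong n (c u) (c′ u) (count-cong n (c u) (c′ u) λ x x<n → eq u x u<n x<n)

count≤ : ∀ n r μ → count n r μ ≤ n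
count≤ n r μ = subst (count n r μ ≤_) (trans (∑-const n 1) (*-identityʳ n))
                 (∑-mono n λ x _ → δ≤1 (r x) μ)

∑-δ-suc≤1 : ∀ m k → ∑ m (λ μ → δ k (suc μ)) ≤ 1
∑-δ-suc≤1 m zero    rewrite ∑-zero m = z≤n
∑-δ-suc≤1 m (suc k) = go m
  where
  go : ∀ m → ∑ m (δ k) ≤ 1
  go zero = z≤n
  go (suc m) with δ k m | δ-test k m
  ... | _ | true refl rewrite trans (∑-cong k λ i i<k → δ-≢ (<⇒≢ i<k ∘ sym)) (∑-zero k) = ≤-refl
  ... | _ | false _ = subst (_≤ 1) (sym (+-identityʳ _)) (go m)

∑-count≤ : ∀ n m r → ∑ m (λ μ → count n r (suc μ)) ≤ n
∑-count≤ n m r rewrite ∑-swap m n (λ μ x → δ (r x) (suc μ)) =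
  subst (∑ n (λ x → ∑ m (λ μ → δ (r x) (suc μ))) ≤_) (trans (∑-const n 1) (*-identityʳ n))
        (∑-mono n λ x _ → ∑-δ-suc≤1 m (r x))

-- Only one factor of each triangular number is replaced by n, since the counts that remain sum to
-- at most n over a row. Bounding each colour separately would cost another factor n.
rowΨ≤ : ∀ n r → rowΨ n r ≤ n * n
rowΨ≤ n r = begin
  rowΨ n r                                          ≤⟨ ∑-mono (n ∸ 1) (λ μ _ → tri≤ (count≤ n r (suc μ))) ⟩
  ∑ (n ∸ 1) (λ μ → count n r (suc μ) * n)           ≡⟨ ∑-*ʳ (n ∸ 1) _ n ⟩
  ∑ (n ∸ 1) (λ μ → count n r (suc μ)) * n           ≤⟨ *-monoˡ-≤ n (∑-count≤ n (n ∸ 1) r) ⟩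
  n * n                                             ∎
  where open ≤-Reasoning

matrixΨ≤ : ∀ n c → matrixΨ n c ≤ n * (n * n)
matrixΨ≤ n c = subst (matrixΨ n c ≤_) (∑-const n (n * n)) (∑-mono n λ u _ → rowΨ≤ n (c u))

rowΨ-transfer : ∀ n {r r′ μ ν} → μ < n ∸ 1 → ν < n ∸ 1 → μ ≢ ν →
  (∀ κ → count n r′ κ + δ κ (suc μ) ≡ count n r κ + δ κ (suc ν)) →
  rowΨ n r′ + count n r (suc μ) ≡ rowΨ n r + suc (count n r (suc ν))
rowΨ-transfer n μ< ν< μ≢ν eq = ∑-tri-transfer (n ∸ 1) μ< ν< μ≢ν (eq ∘ suc)

-- Unordered pairs and sets of columns

Joins : ℕ → ℕ → ℕ → ℕ → Set
Joins a b x y = (a ≡ x × b ≡ y) ⊎ (a ≡ y × b ≡ x)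

joins : ℕ → ℕ → ℕ → ℕ → ℕ
joins a b x y = (δ a x and δ b y) or (δ a y and δ b x)

joins-test : ∀ a b x y → Test (Joins a b x y) (joins a b x y)
joins-test a b x y = or-test (and-test (δ-test a x) (δ-test b y)) (and-test (δ-test a y) (δ-test b x))

joins-sym : ∀ a b x y → joins a b x y ≡ joins a b y x
joins-sym a b x y = test-unique (joins-test a b x y)
  (test-map ⊎-swap ⊎-swap (joins-test a b y x))

mem : ℕ → List ℕ → ℕ
mem x []       = 0
mem x (y ∷ ys) = δ x y or mem x ys

mem-test : ∀ x ys → Test (x ∈ ys) (mem x ys)
mem-test x []       = false λ ()
mem-test x (y ∷ ys) =
  test-map (λ { (inj₁ x≡y) → here x≡y ; (inj₂ x∈ys) → there x∈ys })
           (λ { (here x≡y) → inj₁ x≡y ; (there x∈ys) → inj₂ x∈ys })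
           (or-test (δ-test x y) (mem-test x ys))

mem≤1 : ∀ x ys → mem x ys ≤ 1
mem≤1 x ys with mem x ys | mem-test x ys
... | _ | true  _ = ≤-refl
... | _ | false _ = z≤n

∉⇒mem≡0 : ∀ {x ys} → x ∉ ys → mem x ys ≡ 0
∉⇒mem≡0 {x} {ys} x∉ys with mem x ys | mem-test x ys
... | _ | true x∈ys = contradiction x∈ys x∉ys
... | _ | false _   = refl

mem-∷ : ∀ x {y ys} → y ∉ ys → mem x (y ∷ ys) ≡ mem x ys + δ x y
mem-∷ x {y} {ys} y∉ys with δ x y | δ-test x y
... | _ | true refl = cong (_+ 1) (sym (∉⇒mem≡0 y∉ys))
... | _ | false _   = sym (+-identityʳ _)

∑-mem-∷ : ∀ n {y ys} (g : ℕ → ℕ) → y < n → y ∉ ys →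
          ∑ n (λ x → mem x (y ∷ ys) * g x) ≡ ∑ n (λ x → mem x ys * g x) + g y
∑-mem-∷ n {y} {ys} g y<n y∉ys = begin
  ∑ n (λ x → mem x (y ∷ ys) * g x)                         ≡⟨ ∑-cong n (λ x _ →
    trans (cong (_* g x) (mem-∷ x y∉ys)) (*-distribʳ-+ (g x) (mem x ys) (δ x y))) ⟩
  ∑ n (λ x → mem x ys * g x + δ x y * g x)                 ≡⟨ ∑-distrib-+ n _ _ ⟩
  ∑ n (λ x → mem x ys * g x) + ∑ n (λ x → δ x y * g x)     ≡⟨ cong (∑ n (λ x → mem x ys * g x) +_) (∑-δ n g y<n) ⟩
  ∑ n (λ x → mem x ys * g x) + g y                         ∎
  where open ≡-Reasoning

∑-mem-∷₁ : ∀ n {y ys} → y < n → y ∉ ys → ∑ n (λ x → mem x (y ∷ ys)) ≡ suc (∑ n (λ x → mem x ys))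
∑-mem-∷₁ n {y} {ys} y<n y∉ys = begin
  ∑ n (λ x → mem x (y ∷ ys))            ≡⟨ ∑-cong n (λ x _ → *-identityʳ (mem x (y ∷ ys))) ⟨
  ∑ n (λ x → mem x (y ∷ ys) * 1)        ≡⟨ ∑-mem-∷ n {y} {ys} (λ _ → 1) y<n y∉ys ⟩
  ∑ n (λ x → mem x ys * 1) + 1          ≡⟨ +-comm (∑ n (λ x → mem x ys * 1)) 1 ⟩
  suc (∑ n (λ x → mem x ys * 1))        ≡⟨ cong suc (∑-cong n (λ x _ → *-identityʳ (mem x ys))) ⟩
  suc (∑ n (λ x → mem x ys))            ∎
  where open ≡-Reasoning

∑-mem≤ : ∀ n ys → ∑ n (λ x → mem x ys) ≤ n
∑-mem≤ n ys = subst (∑ n (λ x → mem x ys) ≤_) (trans (∑-const n 1) (*-identityʳ n))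
                (∑-mono n λ x _ → mem≤1 x ys)

-- Recolouring one edge

-- The outer test keeps the diagonal 0 when v = w.
recolour : (ℕ → ℕ → ℕ) → ℕ → ℕ → ℕ → ℕ → ℕ → ℕ
recolour c v w ν x y = if (c x y) (if (joins v w x y) (suc ν) (c x y)) 0

recolour-edgeColouring : ∀ {n c} v w {ν} → EdgeColouring n c → ν < n ∸ 1 →
                         EdgeColouring n (recolour c v w ν)
recolour-edgeColouring {n} {c} v w {ν} col ν< = record
  { symmetric = λ x y → cong₂ (λ i j → if i (if j (suc ν) i) 0) (symmetric x y) (joins-sym v w x y)
  ; diagonal  = λ x → cong (λ i → if i (if (joins v w x x) (suc ν) i) 0) (diagonal x)
  ; positive  = λ {x} {y} x<n y<n x≢y → pos (joins v w x y) (positive x<n y<n x≢y)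
  ; range     = λ x y → bound (joins v w x y) (range x y)
  }
  where
  open EdgeColouring col
  pos : ∀ j {k} → 0 < k → 0 < if k (if j (suc ν) k) 0
  pos zero    {suc k} _ = z<s
  pos (suc j) {suc k} _ = z<s
  bound : ∀ j {k} → k ≤ n ∸ 1 → if k (if j (suc ν) k) 0 ≤ n ∸ 1
  bound j       {zero}  _  = z≤n
  bound zero    {suc k} k≤ = k≤
  bound (suc j) {suc k} _  = ν<

-- The hypothesis is phrased to serve two purposes: for an edge other than vw its premise `Joins` is
-- refuted, and for the loop ww its premise that the entry is not 0 is refuted.
recolour-≡ : ∀ c v w ν x y → (Joins v w x y → c x y ≢ 0 → c x y ≡ suc ν) → recolour c v w ν x y ≡ c x y
recolour-≡ c v w ν x y same with c x y | joins v w x y | joins-test v w x y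
... | zero  | _ | _        = refl
... | suc k | _ | true j   = sym (same j λ ())
... | suc k | _ | false _  = refl

recolour-hit : ∀ c v w ν x y → Joins v w x y → c x y ≢ 0 → recolour c v w ν x y ≡ suc ν
recolour-hit c v w ν x y j c≢0 with c x y | joins v w x y | joins-test v w x y
... | zero  | _ | _        = contradiction refl c≢0
... | suc k | _ | true _   = refl
... | suc k | _ | false ¬j = contradiction j ¬j

-- The alternating walk

-- The colour reached and the columns used so far.
State : Set
State = ℕ × List ℕ

module Walk (n : ℕ) (c : ℕ → ℕ → ℕ) (w u : ℕ) where

  -- The entry 0 marks the diagonal. Column u is therefore refused here, while column w is refused
  -- by `visit`, because the current colour is never 0.
  advance : ℕ → ℕ → State → State
  advance zero    x s = s
  advance (suc κ) x s = suc κ , x ∷ proj₂ s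

  visit : ℕ → State → State
  visit x s = if (δ (c w x) (proj₁ s)) (if (mem x (proj₂ s)) s (advance (c u x) x s)) s

  -- Passing blindly over all columns, instead of looking for an available one, makes the walk a
  -- nested pair of bounded loops, which is a form that a program can have.
  sweep : ℕ → State → State
  sweep j s = primℕ s (λ s x → visit x s) j

  -- A sweep that is not stuck uses a new column, so n sweeps exhaust the walk.
  walk : ℕ → State
  walk κ = primℕ (κ , []) (λ s _ → sweep n s) n

  Available : State → ℕ → Set
  Available (κ , F) x = x ∉ F × c w x ≡ κ × c u x ≢ 0

  visit-view : ∀ x s → (Available s x × visit x s ≡ (c u x , x ∷ proj₂ s)) ⊎ (¬ Available s x × visit x s ≡ s)
  visit-view x s@(κ , F) with δ (c w x) κ | δ-test (c w x) κ
  ... | _ | false ≢κ = inj₂ ((λ { (_ , ≡κ , _) → ≢κ ≡κ }) , refl)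
  ... | _ | true ≡κ with mem x F | mem-test x F
  ...   | _ | true x∈F = inj₂ ((λ { (x∉F , _) → x∉F x∈F }) , refl)
  ...   | _ | false x∉F with c u x
  ...     | zero  = inj₂ ((λ { (_ , _ , ≢0) → ≢0 refl }) , refl)
  ...     | suc κ′ = inj₁ ((x∉F , ≡κ , λ ()) , refl)

  module _ (κ₀ : ℕ) where

    outflow inflow : List ℕ → ℕ → ℕ
    outflow F μ = ∑ n (λ x → mem x F * δ (c w x) μ)
    inflow  F μ = ∑ n (λ x → mem x F * δ (c u x) μ)

    -- `flow` is the degree balance of a trail from `κ₀` to `κ` whose arcs are the columns in `F`.
    -- `card` expresses that no column is listed twice.
    record Invariant (s : State) : Set where
      private
        κ = proj₁ s
        F = proj₂ s
      field
        head-positive : 0 < κ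
        head-range    : κ ≤ n ∸ 1
        bounded       : All (_< n) F
        row-w         : ∀ {x} → x ∈ F → c w x ≢ 0
        row-u         : ∀ {x} → x ∈ F → c u x ≢ 0
        card          : length F ≡ ∑ n (λ x → mem x F)
        flow          : ∀ μ → outflow F μ + δ μ κ ≡ inflow F μ + δ μ κ₀

    open Invariant

    initial : 0 < κ₀ → κ₀ ≤ n ∸ 1 → Invariant (κ₀ , [])
    initial pos range = record
      { head-positive = pos
      ; head-range    = range
      ; bounded       = []
      ; row-w         = λ ()
      ; row-u         = λ ()
      ; card          = sym (∑-zero n)
      ; flow          = λ μ → refl
      }

    module _ (range : ∀ x y → c x y ≤ n ∸ 1) where

      visit-invariant : ∀ {s} x → x < n → Invariant s → Invariant (visit x s)
      visit-invariant {s@(κ , F)} x x<n inv with visit x s | visit-view x s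
      ... | _ | inj₂ (_ , refl) = inv
      ... | _ | inj₁ ((x∉F , ≡κ , ≢0) , refl) = record
        { head-positive = n≢0⇒n>0 ≢0
        ; head-range    = range u x
        ; bounded       = x<n ∷ bounded inv
        ; row-w         = λ { (here refl) eq → <⇒≢ (head-positive inv) (trans (sym eq) ≡κ)
                            ; (there y∈F) → row-w inv y∈F }
        ; row-u         = λ { (here refl) → ≢0 ; (there y∈F) → row-u inv y∈F }
        ; card          = trans (cong suc (card inv)) (sym (∑-mem-∷₁ n x<n x∉F))
        ; flow          = λ μ → begin
            outflow (x ∷ F) μ + δ μ (c u x)               ≡⟨ cong₂ _+_ (∑-mem-∷ n _ x<n x∉F) (δ-sym μ (c u x)) ⟩
            outflow F μ + δ (c w x) μ + δ (c u x) μ       ≡⟨ cong (λ i → outflow F μ + i + δ (c u x) μ)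
                                                                  (trans (cong (λ i → δ i μ) ≡κ) (δ-sym κ μ)) ⟩
            outflow F μ + δ μ κ + δ (c u x) μ             ≡⟨ cong (_+ δ (c u x) μ) (flow inv μ) ⟩
            inflow F μ + δ μ κ₀ + δ (c u x) μ             ≡⟨ +-right-swap (inflow F μ) (δ μ κ₀) (δ (c u x) μ) ⟩
            inflow F μ + δ (c u x) μ + δ μ κ₀             ≡⟨ cong (_+ δ μ κ₀) (∑-mem-∷ n _ x<n x∉F) ⟨
            inflow (x ∷ F) μ + δ μ κ₀                     ∎
        }
        where
        open ≡-Reasoning
        +-right-swap : ∀ a b d → a + b + d ≡ a + d + b
        +-right-swap = solve-∀

      sweep-invariant : ∀ {s} j → j ≤ n → Invariant s → Invariant (sweep j s)
      sweep-invariant zero    _   inv = inv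
      sweep-invariant (suc j) j<n inv = visit-invariant j j<n (sweep-invariant j (<⇒≤ j<n) inv)

      sweeps-invariant : ∀ {s} k → Invariant s → Invariant (primℕ s (λ s _ → sweep n s) k)
      sweeps-invariant zero    inv = inv
      sweeps-invariant (suc k) inv = sweep-invariant n ≤-refl (sweeps-invariant k inv)

      walk-invariant : 0 < κ₀ → κ₀ ≤ n ∸ 1 → Invariant (walk κ₀)
      walk-invariant pos range = sweeps-invariant n (initial pos range)

      Stuck : State → Set
      Stuck s = ∀ x → x < n → ¬ Available s x

      -- As long as nothing has been added, each column is inspected in the original state, so every
      -- refusal is a refusal by that state.
      sweep-progress : ∀ s j → (sweep j s ≡ s × (∀ x → x < j → ¬ Available s x))
                               ⊎ length (proj₂ s) < length (proj₂ (sweep j s))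
      sweep-progress s zero = inj₁ (refl , λ _ ())
      sweep-progress s (suc j) with sweep j s | sweep-progress s j
      ... | s′ | inj₂ grown with visit j s′ | visit-view j s′
      ...   | _ | inj₁ (_ , refl) = inj₂ (m<n⇒m<1+n grown)
      ...   | _ | inj₂ (_ , refl) = inj₂ grown
      sweep-progress s (suc j) | _ | inj₁ (refl , none) with visit j s | visit-view j s
      ...   | _ | inj₁ (_ , refl) = inj₂ ≤-refl
      ...   | _ | inj₂ (¬j , refl) = inj₁ (refl , below)
        where
        below : ∀ x → x < suc j → ¬ Available s x
        below x x<1+j with x ≟ j
        ... | yes refl = ¬j
        ... | no  x≢j  = none x (≤∧≢⇒< (s≤s⁻¹ x<1+j) x≢j)

      stuck-sweep : ∀ {s} → Stuck s → ∀ j → j ≤ n → sweep j s ≡ s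
      stuck-sweep st zero    _ = refl
      stuck-sweep {s} st (suc j) j<n rewrite stuck-sweep st j (<⇒≤ j<n) with visit j s | visit-view j s
      ... | _ | inj₁ (av , _)   = contradiction av (st j j<n)
      ... | _ | inj₂ (_ , refl) = refl

      sweeps-progress : ∀ s k → let s′ = primℕ s (λ s _ → sweep n s) k in
                        Stuck s′ ⊎ k ≤ length (proj₂ s′)
      sweeps-progress s zero = inj₂ z≤n
      sweeps-progress s (suc k) with primℕ s (λ s _ → sweep n s) k | sweeps-progress s k
      ... | s′ | inj₁ stuck rewrite stuck-sweep stuck n ≤-refl = inj₁ stuck
      ... | s′ | inj₂ long with sweep n s′ | sweep-progress s′ n
      ...   | _ | inj₁ (refl , none) = inj₁ none
      ...   | _ | inj₂ grown         = inj₂ (≤-<-trans long grown)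

      -- Either some sweep added nothing, or at least n distinct columns have been used, so that
      -- none below n is left.
      walk-stuck : 0 < κ₀ → κ₀ ≤ n ∸ 1 → Stuck (walk κ₀)
      walk-stuck pos range with sweeps-progress (κ₀ , []) n
      ... | inj₁ stuck = stuck
      ... | inj₂ long  = λ x x<n (x∉F , _) → <⇒≱ (full x x<n x∉F) long
        where
        F = proj₂ (walk κ₀)
        full : ∀ x → x < n → x ∉ F → length F < n
        full x x<n x∉F = begin-strict
          length F                      ≡⟨ card (walk-invariant pos range) ⟩
          ∑ n (λ y → mem y F)           <⟨ ≤-refl ⟩
          suc (∑ n (λ y → mem y F))     ≡⟨ ∑-mem-∷₁ n x<n x∉F ⟨
          ∑ n (λ y → mem y (x ∷ F))     ≤⟨ ∑-mem≤ n (x ∷ F) ⟩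
          n                             ∎
          where open ≤-Reasoning

-- Exchanging two rows on a set of columns

σ : ℕ → ℕ → ℕ → ℕ
σ w u y = if (δ y w) u (if (δ y u) w y)

-- For x in `F` the entries of column x in rows w and u change places, and so do the entries of row
-- x in columns w and u. Treating both coordinates alike keeps the matrix symmetric without a case
-- distinction.
exchange : (ℕ → ℕ → ℕ) → ℕ → ℕ → List ℕ → ℕ → ℕ → ℕ
exchange c w u F x y = c (τ y x) (τ x y)
  where
  τ : ℕ → ℕ → ℕ
  τ x y = if (mem x F) (σ w u y) y

σ-left : ∀ w u → σ w u w ≡ u
σ-left w u rewrite δ-refl w = refl

σ-right : ∀ w u → σ w u u ≡ w
σ-right w u with δ u w | δ-test u w
... | _ | true refl = refl
... | _ | false _ rewrite δ-refl u = refl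

σ-fixed : ∀ {w u y} → y ≢ w → y ≢ u → σ w u y ≡ y
σ-fixed y≢w y≢u rewrite δ-≢ y≢w | δ-≢ y≢u = refl

σ-id : ∀ w y → σ w w y ≡ y
σ-id w y with δ y w | δ-test y w
... | _ | true refl = refl
... | _ | false _   = refl

σ-< : ∀ {n w u y} → w < n → u < n → y < n → σ w u y < n
σ-< {w = w} {u} {y} w<n u<n y<n with δ y w | δ y u
... | suc _ | _     = u<n
... | zero  | suc _ = w<n
... | zero  | zero  = y<n

σ-≢ : ∀ {w u x z} → z ≢ w → z ≢ u → x ≢ z → σ w u x ≢ z
σ-≢ {w} {u} {x} z≢w z≢u x≢z with δ x w | δ x u
... | suc _ | _     = z≢u ∘ sym
... | zero  | suc _ = z≢w ∘ sym
... | zero  | zero  = x≢z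

∑-σ : ∀ n {w u} (f : ℕ → ℕ) → w < n → u < n → ∑ n (f ∘ σ w u) ≡ ∑ n f
∑-σ n {w} {u} f w<n u<n with w ≟ u
... | yes refl = ∑-cong n λ y _ → cong f (σ-id w y)
... | no  w≢u  = +-cancelʳ-≡ (f w + f u) _ _ (begin
  ∑ n (f ∘ σ w u) + (f w + f u)                 ≡⟨ ∑-update₂ n w<n u<n w≢u (λ y _ y≢w y≢u → cong f (σ-fixed y≢w y≢u)) ⟩
  ∑ n f + (f (σ w u w) + f (σ w u u))           ≡⟨ cong (∑ n f +_) (cong₂ _+_ (cong f (σ-left w u)) (cong f (σ-right w u))) ⟩
  ∑ n f + (f u + f w)                           ≡⟨ cong (∑ n f +_) (+-comm (f u) (f w)) ⟩
  ∑ n f + (f w + f u)                           ∎)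
  where open ≡-Reasoning

exchange-unmoved : ∀ c {w u F x y} → x ≢ w → x ≢ u → y ≢ w → y ≢ u → exchange c w u F x y ≡ c x y
exchange-unmoved c {w} {u} {F} {x} {y} x≢w x≢u y≢w y≢u =
  cong₂ c (τ-fixed (mem y F) x≢w x≢u) (τ-fixed (mem x F) y≢w y≢u)
  where
  τ-fixed : ∀ i {z} → z ≢ w → z ≢ u → if i (σ w u z) z ≡ z
  τ-fixed zero    _   _   = refl
  τ-fixed (suc _) z≢w z≢u = σ-fixed z≢w z≢u

exchange-self : ∀ c w F x y → exchange c w w F x y ≡ c x y
exchange-self c w F x y = cong₂ c (τ-id (mem y F) x) (τ-id (mem x F) y)
  where
  τ-id : ∀ i z → if i (σ w w z) z ≡ z
  τ-id zero    z = refl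
  τ-id (suc _) z = σ-id w z

module Exchange {n : ℕ} {c : ℕ → ℕ → ℕ} {w u : ℕ} {F : List ℕ} (col : EdgeColouring n c) (w<n : w < n) (u<n : u < n)
  (row-w : ∀ {x} → x ∈ F → c w x ≢ 0) (row-u : ∀ {x} → x ∈ F → c u x ≢ 0) where

  open EdgeColouring col

  ∈⇒≢w : ∀ {x} → x ∈ F → x ≢ w
  ∈⇒≢w x∈F refl = row-w x∈F (diagonal _)

  ∈⇒≢u : ∀ {x} → x ∈ F → x ≢ u
  ∈⇒≢u x∈F refl = row-u x∈F (diagonal _)

  w∉F : w ∉ F
  w∉F w∈F = ∈⇒≢w w∈F refl

  u∉F : u ∉ F
  u∉F u∈F = ∈⇒≢u u∈F refl

  exchange-edgeColouring : EdgeColouring n (exchange c w u F)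
  exchange-edgeColouring = record
    { symmetric = λ x y → symmetric _ _
    ; diagonal  = λ x → diagonal _
    ; positive  = λ {x} {y} x<n y<n x≢y →
        positive (τ-< (mem y F) x<n) (τ-< (mem x F) y<n) (distinct x≢y)
    ; range     = λ x y → range _ _
    }
    where
    τ-< : ∀ i {z} → z < n → if i (σ w u z) z < n
    τ-< zero    z<n = z<n
    τ-< (suc _) z<n = σ-< w<n u<n z<n
    -- An element of `F` is neither w nor u, so `σ` fixes it and sends no other vertex to it.
    distinct : ∀ {x y} → x ≢ y → if (mem y F) (σ w u x) x ≢ if (mem x F) (σ w u y) y
    distinct {x} {y} x≢y with mem x F | mem-test x F | mem y F | mem-test y F
    ... | _ | true x∈F | _ | true y∈F =
      subst₂ _≢_ (sym (σ-fixed (∈⇒≢w x∈F) (∈⇒≢u x∈F))) (sym (σ-fixed (∈⇒≢w y∈F) (∈⇒≢u y∈F))) x≢y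
    ... | _ | true x∈F | _ | false _  = σ-≢ (∈⇒≢w x∈F) (∈⇒≢u x∈F) (x≢y ∘ sym) ∘ sym
    ... | _ | false _  | _ | true y∈F = σ-≢ (∈⇒≢w y∈F) (∈⇒≢u y∈F) x≢y
    ... | _ | false _  | _ | false _  = x≢y

  exchange-row-w : ∀ x → exchange c w u F w x ≡ if (mem x F) (c u x) (c w x)
  exchange-row-w x rewrite ∉⇒mem≡0 w∉F with mem x F
  ... | zero  = refl
  ... | suc _ = cong (λ z → c z x) (σ-left w u)

  exchange-row-u : ∀ x → exchange c w u F u x ≡ if (mem x F) (c w x) (c u x)
  exchange-row-u x rewrite ∉⇒mem≡0 u∉F with mem x F
  ... | zero  = refl
  ... | suc _ = cong (λ z → c z x) (σ-right w u)

  count-mix : ∀ (r r′ r″ : ℕ → ℕ) → (∀ x → r″ x ≡ if (mem x F) (r′ x) (r x)) → ∀ μ →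
    count n r″ μ + ∑ n (λ x → mem x F * δ (r x) μ) ≡ count n r μ + ∑ n (λ x → mem x F * δ (r′ x) μ)
  count-mix r r′ r″ eq μ = trans (sym (∑-distrib-+ n _ _)) (trans (∑-cong n pointwise) (∑-distrib-+ n _ _))
    where
    swap : ∀ a b → a + (b + 0) ≡ b + (a + 0)
    swap = solve-∀
    pointwise : ∀ x → x < n → δ (r″ x) μ + mem x F * δ (r x) μ ≡ δ (r x) μ + mem x F * δ (r′ x) μ
    pointwise x _ rewrite eq x with mem x F | mem-test x F
    ... | _ | true  _ = swap (δ (r′ x) μ) (δ (r x) μ)
    ... | _ | false _ = refl

  -- Row x is either left alone or has its entries in columns w and u swapped, so its colours are
  -- merely permuted.
  count-other : ∀ {x} → x ≢ w → x ≢ u → ∀ μ → count n (exchange c w u F x) μ ≡ count n (c x) μ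
  count-other {x} x≢w x≢u μ = trans
    (∑-cong n λ y _ → cong (λ z → δ (c z (if (mem x F) (σ w u y) y)) μ) (τ-fixed (mem y F)))
    (permuted (mem x F))
    where
    τ-fixed : ∀ i → if i (σ w u x) x ≡ x
    τ-fixed zero    = refl
    τ-fixed (suc _) = σ-fixed x≢w x≢u
    permuted : ∀ i → ∑ n (λ y → δ (c x (if i (σ w u y) y)) μ) ≡ count n (c x) μ
    permuted zero    = refl
    permuted (suc _) = ∑-σ n (λ y → δ (c x y) μ) w<n u<n

-- The exchange along a stuck walk

module Rebalance {n : ℕ} {c : ℕ → ℕ → ℕ} {w u κ₀ : ℕ} (col : EdgeColouring n c) (w<n : w < n) (u<n : u < n)
  (κ₀-positive : 0 < κ₀) (κ₀-range : κ₀ ≤ n ∸ 1) where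

  open EdgeColouring col
  open Walk n c w u

  private
    s  = walk κ₀
    κ  = proj₁ s
    F  = proj₂ s
    c′ = exchange c w u F

  open Invariant (walk-invariant κ₀ range κ₀-positive κ₀-range)
  open Exchange {F = F} col w<n u<n row-w row-u

  rebalanced-edgeColouring : EdgeColouring n c′
  rebalanced-edgeColouring = exchange-edgeColouring

  -- The exchange trades the outflow of w for the inflow, and by `flow` the two differ only at the
  -- ends of the walk. Both are added on either side and then cancelled, which avoids subtraction.
  count-w : ∀ μ → count n (c′ w) μ + δ μ κ₀ ≡ count n (c w) μ + δ μ κ
  count-w μ = +-cancelʳ-≡ (outflow κ₀ F μ + inflow κ₀ F μ) _ _ (begin
    a′ + k₀ + (o + i)    ≡⟨ regroup a′ k₀ o i ⟩
    (a′ + o) + (i + k₀)  ≡⟨ cong₂ _+_ (count-mix (c w) (c u) (c′ w) exchange-row-w μ) (sym (flow μ)) ⟩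
    (a + i) + (o + k)    ≡⟨ regroup′ a k o i ⟩
    a + k + (o + i)      ∎)
    where
    open ≡-Reasoning
    a = count n (c w) μ
    a′ = count n (c′ w) μ
    o = outflow κ₀ F μ
    i = inflow κ₀ F μ
    k = δ μ κ
    k₀ = δ μ κ₀
    regroup : ∀ a k o i → a + k + (o + i) ≡ (a + o) + (i + k)
    regroup = solve-∀
    regroup′ : ∀ a k o i → (a + i) + (o + k) ≡ a + k + (o + i)
    regroup′ = solve-∀

  count-u : ∀ μ → count n (c′ u) μ + δ μ κ ≡ count n (c u) μ + δ μ κ₀
  count-u μ = +-cancelʳ-≡ (outflow κ₀ F μ + inflow κ₀ F μ) _ _ (begin
    b′ + k + (o + i)     ≡⟨ regroup b′ k o i ⟩
    (b′ + i) + (o + k)   ≡⟨ cong₂ _+_ (count-mix (c u) (c w) (c′ u) exchange-row-u μ) (flow μ) ⟩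
    (b + o) + (i + k₀)   ≡⟨ regroup′ b k₀ o i ⟩
    b + k₀ + (o + i)     ∎)
    where
    open ≡-Reasoning
    b = count n (c u) μ
    b′ = count n (c′ u) μ
    o = outflow κ₀ F μ
    i = inflow κ₀ F μ
    k = δ μ κ
    k₀ = δ μ κ₀
    regroup : ∀ a k o i → a + k + (o + i) ≡ (a + i) + (o + k)
    regroup = solve-∀
    regroup′ : ∀ a k o i → (a + o) + (i + k) ≡ a + k + (o + i)
    regroup′ = solve-∀

  -- The walk is stuck, so it has used every column in which row w has colour `κ`. Only column u,
  -- where row u has no colour, can be left over.
  count-w≤ : count n (c w) κ ≤ outflow κ₀ F κ + δ (c w u) κ
  count-w≤ = begin
    count n (c w) κ
      ≤⟨ ∑-mono n pointwise ⟩
    ∑ n (λ x → mem x F * δ (c w x) κ + δ x u * δ (c w x) κ)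
      ≡⟨ trans (∑-distrib-+ n _ _) (cong (outflow κ₀ F κ +_) (∑-δ n (λ x → δ (c w x) κ) u<n)) ⟩
    outflow κ₀ F κ + δ (c w u) κ
      ∎
    where
    open ≤-Reasoning
    pointwise : ∀ x → x < n → δ (c w x) κ ≤ mem x F * δ (c w x) κ + δ x u * δ (c w x) κ
    pointwise x x<n with mem x F | mem-test x F | δ x u | δ-test x u
    ... | _ | true _    | _ | _       = m≤n⇒m≤n+o _ (m≤m+n _ 0)
    ... | _ | false _   | _ | true _  = m≤m+n _ 0
    ... | _ | false x∉F | _ | false x≢u with δ (c w x) κ | δ-test (c w x) κ
    ...   | _ | false _ = z≤n
    ...   | _ | true ≡κ = contradiction
      (x∉F , ≡κ , >⇒≢ (positive u<n x<n (x≢u ∘ sym))) (walk-stuck κ₀ range κ₀-positive κ₀-range x x<n)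

  count-u≥ : inflow κ₀ F κ + δ (c u w) κ ≤ count n (c u) κ
  count-u≥ = begin
    inflow κ₀ F κ + δ (c u w) κ
      ≡⟨ trans (∑-distrib-+ n _ _) (cong (inflow κ₀ F κ +_) (∑-δ n (λ x → δ (c u x) κ) w<n)) ⟨
    ∑ n (λ x → mem x F * δ (c u x) κ + δ x w * δ (c u x) κ)
      ≤⟨ ∑-mono n (λ x _ → pointwise x) ⟩
    count n (c u) κ
      ∎
    where
    open ≤-Reasoning
    pointwise : ∀ x → mem x F * δ (c u x) κ + δ x w * δ (c u x) κ ≤ δ (c u x) κ
    pointwise x with mem x F | mem-test x F | δ x w | δ-test x w
    ... | _ | true x∈F | _ | true x≡w = contradiction x≡w (∈⇒≢w x∈F)
    ... | _ | true _   | _ | false _  = ≤-reflexive (trans (+-identityʳ _) (+-identityʳ _))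
    ... | _ | false _  | _ | true _   = ≤-reflexive (+-identityʳ _)
    ... | _ | false _  | _ | false _  = z≤n

  -- The edge wu enters the two preceding bounds with the same term, by symmetry, and cancels.
  count-balance : count n (c w) κ + inflow κ₀ F κ ≤ count n (c u) κ + outflow κ₀ F κ
  count-balance = begin
    count n (c w) κ + i             ≤⟨ +-monoˡ-≤ i count-w≤ ⟩
    o + δ (c w u) κ + i             ≡⟨ cong (λ k → o + δ k κ + i) (symmetric w u) ⟩
    o + δ (c u w) κ + i             ≡⟨ regroup o (δ (c u w) κ) i ⟩
    i + δ (c u w) κ + o             ≤⟨ +-monoˡ-≤ o count-u≥ ⟩
    count n (c u) κ + o             ∎
    where
    open ≤-Reasoning
    o = outflow κ₀ F κ
    i = inflow κ₀ F κ
    regroup : ∀ a b d → a + b + d ≡ d + b + a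
    regroup = solve-∀

  -- A closed walk has equal outflow and inflow at its colour, and then `count-balance` contradicts
  -- the gap. An open one has entered its last colour once more than it has left it, and this
  -- surplus makes the inequality strict.
  walk-end : count n (c u) κ₀ < count n (c w) κ₀ → κ ≢ κ₀ × count n (c w) κ < count n (c u) κ
  walk-end gap with κ ≟ κ₀ | flow κ
  ... | yes κ≡κ₀ | eq = contradiction le (<⇒≱ (subst (λ k → count n (c u) k < count n (c w) k) (sym κ≡κ₀) gap))
    where
    le : count n (c w) κ ≤ count n (c u) κ
    le = +-cancelʳ-≤ (inflow κ₀ F κ) _ _ (subst (λ o → count n (c w) κ + inflow κ₀ F κ ≤ count n (c u) κ + o)
           (+-cancelʳ-≡ (δ κ κ₀) _ _ (trans (cong (λ k → outflow κ₀ F κ + δ κ k) (sym κ≡κ₀)) eq)) count-balance)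
  ... | no κ≢κ₀ | eq = κ≢κ₀ , +-cancelʳ-≤ (outflow κ₀ F κ) _ _ (begin
    suc (count n (c w) κ) + o     ≡⟨ +-suc (count n (c w) κ) o ⟨
    count n (c w) κ + suc o       ≡⟨ cong (count n (c w) κ +_) o+1≡i ⟩
    count n (c w) κ + i           ≤⟨ count-balance ⟩
    count n (c u) κ + o           ∎)
    where
    open ≤-Reasoning
    o = outflow κ₀ F κ
    i = inflow κ₀ F κ
    o+1≡i : suc o ≡ i
    o+1≡i = trans (trans (+-comm 1 o) (cong (o +_) (sym (δ-refl κ))))
                  (trans eq (trans (cong (i +_) (δ-≢ κ≢κ₀)) (+-identityʳ i)))

rowΨ-transfer′ : ∀ n {r r′ μ ν} → 0 < μ → μ ≤ n ∸ 1 → 0 < ν → ν ≤ n ∸ 1 → μ ≢ ν →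
  (∀ κ → count n r′ κ + δ κ μ ≡ count n r κ + δ κ ν) →
  rowΨ n r′ + count n r μ ≡ rowΨ n r + suc (count n r ν)
rowΨ-transfer′ n {r} {r′} {suc μ} {suc ν} _ μ≤ _ ν≤ μ≢ν eq =
  rowΨ-transfer n {r} {r′} μ≤ ν≤ (μ≢ν ∘ cong suc) eq

-- Moving one `κ₀` from w to u saves at least 1, because the counts differ by at least 2. Moving one
-- `κ` back costs nothing, because w had fewer of them than u. No other row changes its counts.
rebalance-decreases : ∀ {n c w u κ₀} → EdgeColouring n c → w < n → u < n → w ≢ u →
  0 < κ₀ → κ₀ ≤ n ∸ 1 → 2 + count n (c u) κ₀ ≤ count n (c w) κ₀ →
  matrixΨ n (exchange c w u (proj₂ (Walk.walk n c w u κ₀))) < matrixΨ n c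
rebalance-decreases {n} {c} {w} {u} {κ₀} col w<n u<n w≢u pos rng gap =
  +-cancelʳ-≤ (a₀ + b + (Rw + Ru)) _ _ (begin
    suc Ψ′ + (a₀ + b + (Rw + Ru))                ≡⟨ p₁ Ψ′ a₀ b (Rw + Ru) ⟩
    suc (Ψ′ + (Rw + Ru) + (a₀ + b))              ≡⟨ cong (λ z → suc (z + (a₀ + b))) total ⟩
    suc (Ψ₀ + (Rw′ + Ru′) + (a₀ + b))            ≡⟨ p₂ Ψ₀ Rw′ Ru′ a₀ b ⟩
    suc (Ψ₀ + ((Rw′ + a₀) + (Ru′ + b)))          ≡⟨ cong (λ z → suc (Ψ₀ + z)) (cong₂ _+_ eq-w eq-u) ⟩
    suc (Ψ₀ + ((Rw + suc a) + (Ru + suc b₀)))    ≡⟨ p₃ Ψ₀ Rw Ru a b₀ ⟩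
    Ψ₀ + ((2 + b₀) + suc a + (Rw + Ru))          ≤⟨ +-monoʳ-≤ Ψ₀ (+-monoˡ-≤ (Rw + Ru) (+-mono-≤ gap (proj₂ end))) ⟩
    Ψ₀ + (a₀ + b + (Rw + Ru))                    ∎)
  where
  open ≤-Reasoning
  open Walk n c w u
  open Rebalance {n} {c} {w} {u} {κ₀} col w<n u<n pos rng
  inv = walk-invariant κ₀ (EdgeColouring.range col) pos rng
  open Invariant inv
  open Exchange {F = proj₂ (walk κ₀)} col w<n u<n row-w row-u
  κ = proj₁ (walk κ₀)
  c′ = exchange c w u (proj₂ (walk κ₀))
  Ψ′ = matrixΨ n c′
  Ψ₀ = matrixΨ n c
  Rw = rowΨ n (c w)
  Ru = rowΨ n (c u)
  Rw′ = rowΨ n (c′ w)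
  Ru′ = rowΨ n (c′ u)
  a₀ = count n (c w) κ₀
  b₀ = count n (c u) κ₀
  a = count n (c w) κ
  b = count n (c u) κ
  end : κ ≢ κ₀ × a < b
  end = walk-end (<-trans (n<1+n b₀) gap)
  total : Ψ′ + (Rw + Ru) ≡ Ψ₀ + (Rw′ + Ru′)
  total = ∑-update₂ n {f = λ x → rowΨ n (c x)} {g = λ x → rowΨ n (c′ x)} w<n u<n w≢u
            λ x _ x≢w x≢u → rowΨ-cong n (c′ x) (c x) (count-other x≢w x≢u)
  eq-w : Rw′ + a₀ ≡ Rw + suc a
  eq-w = rowΨ-transfer′ n {c w} {c′ w} pos rng head-positive head-range (proj₁ end ∘ sym) count-w
  eq-u : Ru′ + b ≡ Ru + suc b₀
  eq-u = rowΨ-transfer′ n {c u} {c′ u} head-positive head-range pos rng (proj₁ end) count-u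
  p₁ : ∀ x a b r → suc x + (a + b + r) ≡ suc (x + r + (a + b))
  p₁ = solve-∀
  p₂ : ∀ x r s a b → suc (x + (r + s) + (a + b)) ≡ suc (x + ((r + a) + (s + b)))
  p₂ = solve-∀
  p₃ : ∀ x r s a b → suc (x + ((r + suc a) + (s + suc b))) ≡ x + ((2 + b) + suc a + (r + s))
  p₃ = solve-∀

-- The improving move

candidate : ℕ → (ℕ → ℕ → ℕ) → ℕ → ℕ → ℕ → ℕ → ℕ → ℕ → ℕ
candidate n c v w u ν = exchange c₁ w u (proj₂ (Walk.walk n c₁ w u (suc ν)))
  where c₁ = recolour c v w ν

candidate-edgeColouring : ∀ {n c} v {w u ν} → EdgeColouring n c → w < n → u < n → ν < n ∸ 1 →
                          EdgeColouring n (candidate n c v w u ν)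
candidate-edgeColouring v {w} col w<n u<n ν< =
  Rebalance.rebalanced-edgeColouring (recolour-edgeColouring v w col ν<) w<n u<n z<s ν<

module _ {n : ℕ} {c : ℕ → ℕ → ℕ} (col : EdgeColouring n c) where

  open EdgeColouring col

  -- The diagonal entry of row v carries no colour. The summand `δ x v * 1` fills this gap, so that
  -- every column contributes at most 1.
  ∑-count< : ∀ {v} → v < n → ∑ (n ∸ 1) (λ μ → count n (c v) (suc μ)) < n
  ∑-count< {v} v<n = begin-strict
    ∑ (n ∸ 1) (λ μ → count n (c v) (suc μ))                <⟨ ≤-refl ⟩
    suc (∑ (n ∸ 1) (λ μ → count n (c v) (suc μ)))          ≡⟨ cong suc (∑-swap (n ∸ 1) n λ μ x → δ (c v x) (suc μ)) ⟩
    suc (∑ n g)                                            ≡⟨ +-comm 1 (∑ n g) ⟩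
    ∑ n g + 1                                              ≡⟨ cong (∑ n g +_) (∑-δ n (λ _ → 1) v<n) ⟨
    ∑ n g + ∑ n (λ x → δ x v * 1)                          ≡⟨ ∑-distrib-+ n _ _ ⟨
    ∑ n (λ x → g x + δ x v * 1)                            ≤⟨ ∑-mono n (λ x _ → pointwise x) ⟩
    ∑ n (λ _ → 1)                                          ≡⟨ trans (∑-const n 1) (*-identityʳ n) ⟩
    n                                                      ∎
    where
    open ≤-Reasoning
    g : ℕ → ℕ
    g x = ∑ (n ∸ 1) (λ μ → δ (c v x) (suc μ))
    pointwise : ∀ x → g x + δ x v * 1 ≤ 1
    pointwise x with δ x v | δ-test x v
    ... | _ | true refl rewrite diagonal v = ≤-reflexive (cong (_+ 1) (∑-zero (n ∸ 1)))
    ... | _ | false _ = ≤-trans (≤-reflexive (+-identityʳ _)) (∑-δ-suc≤1 (n ∸ 1) (c v x))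

  -- If all n - 1 colours occurred, one of them twice, then row v would have at least n coloured
  -- entries.
  missing-colour : ∀ {v μ} → v < n → μ < n ∸ 1 → 2 ≤ count n (c v) (suc μ) →
                   ∃[ ν ] ν < n ∸ 1 × count n (c v) (suc ν) ≡ 0
  missing-colour {v} {μ} v<n μ< repeated
    with anyUpTo? (λ ν → count n (c v) (suc ν) ≟ 0) (n ∸ 1)
  ... | yes found = found
  ... | no  none  = contradiction (∑-count< v<n) (≤⇒≯ (begin
    n                                                    ≤⟨ m≤n+m∸n n 1 ⟩
    1 + (n ∸ 1)                                          ≡⟨ +-comm 1 (n ∸ 1) ⟩
    n ∸ 1 + 1                                            ≡⟨ cong₂ _+_ (trans (∑-const (n ∸ 1) 1) (*-identityʳ _))
                                                                      (∑-δ (n ∸ 1) (λ _ → 1) μ<) ⟨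
    ∑ (n ∸ 1) (λ _ → 1) + ∑ (n ∸ 1) (λ ν → δ ν μ * 1)    ≡⟨ ∑-distrib-+ (n ∸ 1) _ _ ⟨
    ∑ (n ∸ 1) (λ ν → 1 + δ ν μ * 1)                      ≤⟨ ∑-mono (n ∸ 1) pointwise ⟩
    ∑ (n ∸ 1) (λ ν → count n (c v) (suc ν))              ∎))
    where
    open ≤-Reasoning
    pointwise : ∀ ν → ν < n ∸ 1 → 1 + δ ν μ * 1 ≤ count n (c v) (suc ν)
    pointwise ν ν< with δ ν μ | δ-test ν μ
    ... | _ | true refl = repeated
    ... | _ | false _   = n≢0⇒n>0 λ eq → none (ν , ν< , eq)

  -- Every colour has an even number of edge ends, so it cannot be missing at exactly
  -- one of an even number of vertices and occur once at all the others.
  second-missing : ∀ {v ν} → 2 ∣ n → v < n → count n (c v) (suc ν) ≡ 0 →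
                   (∀ x → x < n → count n (c x) (suc ν) ≤ 1) →
                   ∃[ u ] u < n × u ≢ v × count n (c u) (suc ν) ≡ 0
  second-missing {v} {ν} 2∣n v<n missing ≤1
    with anyUpTo? (λ u → ¬? (u ≟ v) ×-dec (count n (c u) (suc ν) ≟ 0)) n
  ... | yes (u , u<n , u≢v , eq) = u , u<n , u≢v , eq
  ... | no  none = contradiction
    (∣1⇒≡1 (∣m+n∣m⇒∣n (subst (2 ∣_) (sym total) 2∣n)
                       (∑-symmetric-even n (λ x y → δ (c x y) (suc ν))
                          (λ x y → cong (λ k → δ k (suc ν)) (symmetric x y))
                          (λ x → cong (λ k → δ k (suc ν)) (diagonal x)))))
    λ ()
    where
    ends : ℕ
    ends = ∑ n (λ x → count n (c x) (suc ν))
    pointwise : ∀ x → x < n → count n (c x) (suc ν) + δ x v * 1 ≡ 1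
    pointwise x x<n with δ x v | δ-test x v
    ... | _ | true refl = cong (_+ 1) missing
    ... | _ | false x≢v = trans (+-identityʳ _)
      (≤-antisym (≤1 x x<n) (n≢0⇒n>0 λ eq → none (x , x<n , x≢v , eq)))
    total : ends + 1 ≡ n
    total = begin
      ends + 1                                             ≡⟨ cong (ends +_) (∑-δ n (λ _ → 1) v<n) ⟨
      ends + ∑ n (λ x → δ x v * 1)                         ≡⟨ ∑-distrib-+ n _ _ ⟨
      ∑ n (λ x → count n (c x) (suc ν) + δ x v * 1)        ≡⟨ ∑-cong n pointwise ⟩
      ∑ n (λ _ → 1)                                        ≡⟨ trans (∑-const n 1) (*-identityʳ n) ⟩
      n                                                    ∎
      where open ≡-Reasoning

  module _ {v w μ ν : ℕ} (v<n : v < n) (w<n : w < n) (ν< : ν < n ∸ 1) (cvw : c v w ≡ suc μ) where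

    private
      c₁ = recolour c v w ν
      cwv : c w v ≡ suc μ
      cwv = trans (symmetric w v) cvw
      μ< : μ < n ∸ 1
      μ< = subst (_≤ n ∸ 1) cvw (range v w)

    v≢w : v ≢ w
    v≢w refl = 0≢1+n (trans (sym (diagonal v)) cvw)

    recolour-count-v : ∀ κ → count n (c₁ v) κ + δ κ (suc μ) ≡ count n (c v) κ + δ κ (suc ν)
    recolour-count-v κ = subst₂ (λ i j → count n (c₁ v) κ + i ≡ count n (c v) κ + j)
      (trans (cong (λ k → δ k κ) cvw) (δ-sym (suc μ) κ))
      (trans (cong (λ k → δ k κ) (recolour-hit c v w ν v w (inj₁ (refl , refl)) λ eq → 0≢1+n (trans (sym eq) cvw))) (δ-sym (suc ν) κ))
      (∑-update n w<n λ x _ x≢w → cong (λ k → δ k κ)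
        (recolour-≡ c v w ν v x λ { (inj₁ (_ , w≡x)) → contradiction (sym w≡x) x≢w
                        ; (inj₂ (_ , w≡v)) → contradiction (sym w≡v) v≢w }))

    recolour-count-w : ∀ κ → count n (c₁ w) κ + δ κ (suc μ) ≡ count n (c w) κ + δ κ (suc ν)
    recolour-count-w κ = subst₂ (λ i j → count n (c₁ w) κ + i ≡ count n (c w) κ + j)
      (trans (cong (λ k → δ k κ) cwv) (δ-sym (suc μ) κ))
      (trans (cong (λ k → δ k κ) (recolour-hit c v w ν w v (inj₂ (refl , refl)) λ eq → 0≢1+n (trans (sym eq) cwv))) (δ-sym (suc ν) κ))
      (∑-update n v<n λ x _ x≢v → cong (λ k → δ k κ)
        (recolour-≡ c v w ν w x λ { (inj₁ (v≡w , _)) → contradiction v≡w v≢w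
                        ; (inj₂ (v≡x , _)) → contradiction (sym v≡x) x≢v }))

    recolour-count-other : ∀ {x} → x ≢ v → x ≢ w → ∀ κ → count n (c₁ x) κ ≡ count n (c x) κ
    recolour-count-other {x} x≢v x≢w = count-cong n (c₁ x) (c x) λ y _ →
      recolour-≡ c v w ν x y λ { (inj₁ (v≡x , _)) → contradiction (sym v≡x) x≢v
                     ; (inj₂ (_ , w≡x)) → contradiction (sym w≡x) x≢w }

    -- At v, losing one of several μ's saves at least 1 and the new ν is free. At w, losing a μ
    -- never costs anything, and the new ν costs the number of ν's already there.
    recolour-Ψ : 2 ≤ count n (c v) (suc μ) → count n (c v) (suc ν) ≡ 0 →
                 matrixΨ n c₁ < matrixΨ n c + count n (c w) (suc ν)
    recolour-Ψ repeated missing = +-cancelʳ-≤ (Rv + Rw + 2) _ _ (begin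
      suc Ψ₁ + (Rv + Rw + 2)                        ≡⟨ p₁ Ψ₁ (Rv + Rw) ⟩
      Ψ₁ + (Rv + Rw) + (2 + 1)                      ≡⟨ cong (_+ (2 + 1)) total ⟩
      Ψ₀ + (Rv′ + Rw′) + (2 + 1)                    ≤⟨ +-monoʳ-≤ (Ψ₀ + (Rv′ + Rw′)) (+-mono-≤ repeated once) ⟩
      Ψ₀ + (Rv′ + Rw′) + (av + aw)                  ≡⟨ p₂ Ψ₀ Rv′ Rw′ av aw ⟩
      Ψ₀ + ((Rv′ + av) + (Rw′ + aw))                ≡⟨ cong (Ψ₀ +_) (cong₂ _+_ eq-v eq-w) ⟩
      Ψ₀ + ((Rv + 1) + (Rw + suc bw))               ≡⟨ p₃ Ψ₀ Rv Rw bw ⟩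
      Ψ₀ + bw + (Rv + Rw + 2)                       ∎)
      where
      open ≤-Reasoning
      Ψ₀ = matrixΨ n c
      Ψ₁ = matrixΨ n c₁
      Rv = rowΨ n (c v)
      Rw = rowΨ n (c w)
      Rv′ = rowΨ n (c₁ v)
      Rw′ = rowΨ n (c₁ w)
      av = count n (c v) (suc μ)
      aw = count n (c w) (suc μ)
      bw = count n (c w) (suc ν)
      μ≢ν : μ ≢ ν
      μ≢ν refl = <⇒≢ (<-≤-trans z<s repeated) (sym missing)
      once : 1 ≤ aw
      once = subst (_≤ aw) (trans (cong (λ k → δ k (suc μ)) cwv) (δ-refl μ)) (term≤∑ n (λ x → δ (c w x) (suc μ)) v<n)
      total : Ψ₁ + (Rv + Rw) ≡ Ψ₀ + (Rv′ + Rw′)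
      total = ∑-update₂ n {f = λ x → rowΨ n (c x)} {g = λ x → rowΨ n (c₁ x)} v<n w<n v≢w
                λ x _ x≢v x≢w → rowΨ-cong n (c₁ x) (c x) (recolour-count-other x≢v x≢w)
      eq-v : Rv′ + av ≡ Rv + 1
      eq-v = trans (rowΨ-transfer n {c v} {c₁ v} μ< ν< μ≢ν recolour-count-v) (cong (λ k → Rv + suc k) missing)
      eq-w : Rw′ + aw ≡ Rw + suc bw
      eq-w = rowΨ-transfer n {c w} {c₁ w} μ< ν< μ≢ν recolour-count-w
      p₁ : ∀ x r → suc x + (r + 2) ≡ x + r + (2 + 1)
      p₁ = solve-∀
      p₂ : ∀ x r s a b → x + (r + s) + (a + b) ≡ x + ((r + a) + (s + b))
      p₂ = solve-∀
      p₃ : ∀ x r s b → x + ((r + 1) + (s + suc b)) ≡ x + b + (r + s + 2)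
      p₃ = solve-∀

  Improving : Set
  Improving = ∃[ v ] ∃[ w ] ∃[ u ] ∃[ ν ] v < n × w < n × u < n × ν < n ∸ 1 ×
              matrixΨ n (candidate n c v w u ν) < matrixΨ n c

  -- The first edge of the candidate is the loop ww, so that nothing is recoloured.
  unbalanced-improving : ∀ {w u ν} → w < n → u < n → ν < n ∸ 1 →
    2 + count n (c u) (suc ν) ≤ count n (c w) (suc ν) → Improving
  unbalanced-improving {w} {u} {ν} w<n u<n ν< gap =
    w , w , u , ν , w<n , w<n , u<n , ν< ,
    subst (matrixΨ n (candidate n c w w u ν) <_) (matrixΨ-cong n {c₁} {c} λ x y _ _ → unchanged x y)
      (rebalance-decreases (recolour-edgeColouring w w col ν<) w<n u<n w≢u z<s ν<
        (subst₂ (λ i j → 2 + i ≤ j) (sym (same-count u)) (sym (same-count w)) gap))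
    where
    c₁ = recolour c w w ν
    unchanged : ∀ x y → c₁ x y ≡ c x y
    unchanged x y = recolour-≡ c w w ν x y λ
      { (inj₁ (refl , refl)) ≢0 → contradiction (diagonal w) ≢0
      ; (inj₂ (refl , refl)) ≢0 → contradiction (diagonal w) ≢0 }
    same-count : ∀ x → count n (c₁ x) (suc ν) ≡ count n (c x) (suc ν)
    same-count x = count-cong n (c₁ x) (c x) (λ y _ → unchanged x y) (suc ν)
    w≢u : w ≢ u
    w≢u refl = <⇒≱ (n<1+n _) (≤-trans (n≤1+n _) gap)

  module _ (2∣n : 2 ∣ n)
    (balanced : ∀ {x y ν} → x < n → y < n → ν < n ∸ 1 → count n (c x) (suc ν) ≤ suc (count n (c y) (suc ν)))
    where

    balanced-improving : ∀ {v μ} → v < n → μ < n ∸ 1 → 2 ≤ count n (c v) (suc μ) → Improving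
    balanced-improving {v} {μ} v<n μ< repeated
      with ∑-positive n (λ x → δ (c v x) (suc μ)) (<-≤-trans z<s repeated) | missing-colour v<n μ< repeated
    ... | w , w<n , hit | ν , ν< , missing with δ (c v w) (suc μ) | δ-test (c v w) (suc μ) | hit
    ... | _ | true cvw | _ with count n (c w) (suc ν) ≟ 0
    -- Taking w also as the second centre makes the exchange trivial, so this candidate is the
    -- recolouring alone.
    ...   | yes absent = v , w , w , ν , v<n , w<n , w<n , ν< ,
      subst₂ _<_
        (matrixΨ-cong n {recolour c v w ν} {candidate n c v w w ν}
          λ x y _ _ → sym (exchange-self (recolour c v w ν) w (proj₂ (Walk.walk n (recolour c v w ν) w w (suc ν))) x y))
        (trans (cong (matrixΨ n c +_) absent) (+-identityʳ _))
        (recolour-Ψ v<n w<n ν< cvw repeated missing)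
    ...   | no present with second-missing 2∣n v<n missing (λ x x<n → ≤1 x x<n)
      where
      ≤1 : ∀ x → x < n → count n (c x) (suc ν) ≤ 1
      ≤1 x x<n = subst (λ k → count n (c x) (suc ν) ≤ suc k) missing (balanced x<n v<n ν<)
    ...     | u , u<n , u≢v , absent = v , w , u , ν , v<n , w<n , u<n , ν< ,
      <-≤-trans (rebalance-decreases (recolour-edgeColouring v w col ν<) w<n u<n w≢u z<s ν< gap)
        (s≤s⁻¹ (subst (matrixΨ n (recolour c v w ν) <_)
                  (trans (cong (matrixΨ n c +_) once) (+-comm (matrixΨ n c) 1))
                  (recolour-Ψ v<n w<n ν< cvw repeated missing)))
      where
      c₁ = recolour c v w ν
      w≢u : w ≢ u
      w≢u refl = present absent
      μ≢ν : μ ≢ ν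
      μ≢ν refl = <⇒≢ (<-≤-trans z<s repeated) (sym missing)
      once : count n (c w) (suc ν) ≡ 1
      once = ≤-antisym (subst (λ k → count n (c w) (suc ν) ≤ suc k) missing (balanced w<n v<n ν<)) (n≢0⇒n>0 present)
      count₁-w : count n (c₁ w) (suc ν) ≡ 2
      count₁-w = begin
        count n (c₁ w) (suc ν)                       ≡⟨ +-identityʳ _ ⟨
        count n (c₁ w) (suc ν) + 0                   ≡⟨ cong (count n (c₁ w) (suc ν) +_) (δ-≢ (μ≢ν ∘ sym)) ⟨
        count n (c₁ w) (suc ν) + δ ν μ               ≡⟨ recolour-count-w v<n w<n ν< cvw (suc ν) ⟩
        count n (c w) (suc ν) + δ ν ν                ≡⟨ cong₂ _+_ once (δ-refl ν) ⟩
        2                                            ∎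
        where open ≡-Reasoning
      gap : 2 + count n (c₁ u) (suc ν) ≤ count n (c₁ w) (suc ν)
      gap = ≤-reflexive (trans
        (cong (2 +_) (trans (recolour-count-other v<n w<n ν< cvw u≢v (w≢u ∘ sym) (suc ν)) absent))
        (sym count₁-w))

  improving : ∀ {v μ} → 2 ∣ n → v < n → μ < n ∸ 1 → 2 ≤ count n (c v) (suc μ) → Improving
  improving 2∣n v<n μ< repeated
    with anyUpTo? (λ w → anyUpTo? (λ u → anyUpTo? (λ ν → 2 + count n (c u) (suc ν) ≤? count n (c w) (suc ν)) (n ∸ 1)) n) n
  ... | yes (w , w<n , u , u<n , ν , ν< , gap) = unbalanced-improving w<n u<n ν< gap
  ... | no  none = balanced-improving 2∣n
    (λ {x} {y} {ν} x<n y<n ν< → s≤s⁻¹ (≰⇒> λ gap → none (x , x<n , y , y<n , ν , ν< , gap)))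
    v<n μ< repeated

private variable
  Γ : Ctx
  A′ B : Ty

-- Polynomial cost

-- Every recursion performed in the evaluation of t has at most N steps.
mutual
  Ok : ℕ → Tm Γ B → Env Γ → Set
  Ok N (var x)       ρ = ⊤
  Ok N (let′ t b)    ρ = Ok N t ρ × Ok N b (eval t ρ ∷ ρ)
  Ok N (call b t)    ρ = Ok N t ρ × Ok N b (eval t ρ ∷ [])
  Ok N zero′         ρ = ⊤
  Ok N (suc′ t)      ρ = Ok N t ρ
  Ok N (caseℕ t z s) ρ = Ok N t ρ × OkCaseℕ N z s ρ (eval t ρ)
  Ok N (recℕ t z s)  ρ = Ok N t ρ × eval t ρ ≤ N × OkRecℕ N z s ρ (eval t ρ)
  Ok N (pair t u)    ρ = Ok N t ρ × Ok N u ρ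
  Ok N (fst t)       ρ = Ok N t ρ
  Ok N (snd t)       ρ = Ok N t ρ
  Ok N nil           ρ = ⊤
  Ok N (cons t u)    ρ = Ok N t ρ × Ok N u ρ
  Ok N (caseL t z s) ρ = Ok N t ρ × OkCaseL N z s ρ (eval t ρ)
  Ok N (recL t z s)  ρ = Ok N t ρ × length (eval t ρ) ≤ N × OkRecL N z s ρ (eval t ρ)

  OkCaseℕ : ℕ → Tm Γ B → Tm (nat ∷ Γ) B → Env Γ → ℕ → Set
  OkCaseℕ N z s ρ zero    = Ok N z ρ
  OkCaseℕ N z s ρ (suc n) = Ok N s (n ∷ ρ)

  OkCaseL : ℕ → Tm Γ B → Tm (A′ ∷ list A′ ∷ Γ) B → Env Γ → List (Val A′) → Set
  OkCaseL N z s ρ []       = Ok N z ρ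
  OkCaseL N z s ρ (x ∷ xs) = Ok N s (x ∷ xs ∷ ρ)

  OkRecℕ : ℕ → Tm Γ B → Tm (B ∷ nat ∷ Γ) B → Env Γ → ℕ → Set
  OkRecℕ N z s ρ zero    = Ok N z ρ
  OkRecℕ N z s ρ (suc n) =
    OkRecℕ N z s ρ n ×
    Ok N s (primℕ (eval z ρ) (λ r m → eval s (r ∷ m ∷ ρ)) n ∷ n ∷ ρ)

  OkRecL : ℕ → Tm Γ B → Tm (B ∷ A′ ∷ list A′ ∷ Γ) B → Env Γ → List (Val A′) → Set
  OkRecL N z s ρ []       = Ok N z ρ
  OkRecL N z s ρ (x ∷ xs) =
    OkRecL N z s ρ xs ×
    Ok N s (primL (eval z ρ) (λ r y ys → eval s (r ∷ y ∷ ys ∷ ρ)) xs ∷ x ∷ xs ∷ ρ)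

-- A bound that is free of the environment: charging both branches of a case distinction and N steps
-- for each recursion turns a fixed program into a fixed polynomial in N.
staticCost : ℕ → Tm Γ B → ℕ
staticCost N (var x)       = 1
staticCost N (let′ t b)    = suc (staticCost N t + staticCost N b)
staticCost N (call b t)    = suc (staticCost N t + staticCost N b)
staticCost N zero′         = 1
staticCost N (suc′ t)      = suc (staticCost N t)
staticCost N (caseℕ t z s) = suc (staticCost N t + (staticCost N z + staticCost N s))
staticCost N (recℕ t z s)  = suc (staticCost N t + (staticCost N z + N * staticCost N s))
staticCost N (pair t u)    = suc (staticCost N t + staticCost N u)
staticCost N (fst t)       = suc (staticCost N t)
staticCost N (snd t)       = suc (staticCost N t)
staticCost N nil           = 1
staticCost N (cons t u)    = suc (staticCost N t + staticCost N u)
staticCost N (caseL t z s) = suc (staticCost N t + (staticCost N z + staticCost N s))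
staticCost N (recL t z s)  = suc (staticCost N t + (staticCost N z + N * staticCost N s))

mutual
  cost≤ : ∀ {N} (t : Tm Γ B) ρ → Ok N t ρ → cost t ρ ≤ staticCost N t
  cost≤ (var x)       ρ ok               = ≤-refl
  cost≤ (let′ t b)    ρ (ok₁ , ok₂)      = s≤s (+-mono-≤ (cost≤ t ρ ok₁) (cost≤ b _ ok₂))
  cost≤ (call b t)    ρ (ok₁ , ok₂)      = s≤s (+-mono-≤ (cost≤ t ρ ok₁) (cost≤ b _ ok₂))
  cost≤ zero′         ρ ok               = ≤-refl
  cost≤ (suc′ t)      ρ ok               = s≤s (cost≤ t ρ ok)
  cost≤ (caseℕ t z s) ρ (ok₁ , ok₂)      = s≤s (+-mono-≤ (cost≤ t ρ ok₁) (costCaseℕ≤ z s ρ (eval t ρ) ok₂))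
  cost≤ (recℕ t z s)  ρ (ok₁ , le , ok₂) = s≤s (+-mono-≤ (cost≤ t ρ ok₁)
    (≤-trans (costRecℕ≤ z s ρ (eval t ρ) ok₂) (+-monoʳ-≤ _ (*-monoˡ-≤ _ le))))
  cost≤ (pair t u)    ρ (ok₁ , ok₂)      = s≤s (+-mono-≤ (cost≤ t ρ ok₁) (cost≤ u ρ ok₂))
  cost≤ (fst t)       ρ ok               = s≤s (cost≤ t ρ ok)
  cost≤ (snd t)       ρ ok               = s≤s (cost≤ t ρ ok)
  cost≤ nil           ρ ok               = ≤-refl
  cost≤ (cons t u)    ρ (ok₁ , ok₂)      = s≤s (+-mono-≤ (cost≤ t ρ ok₁) (cost≤ u ρ ok₂))
  cost≤ (caseL t z s) ρ (ok₁ , ok₂)      = s≤s (+-mono-≤ (cost≤ t ρ ok₁) (costCaseL≤ z s ρ (eval t ρ) ok₂))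
  cost≤ (recL t z s)  ρ (ok₁ , le , ok₂) = s≤s (+-mono-≤ (cost≤ t ρ ok₁)
    (≤-trans (costRecL≤ z s ρ (eval t ρ) ok₂) (+-monoʳ-≤ _ (*-monoˡ-≤ _ le))))

  costCaseℕ≤ : ∀ {N} (z : Tm Γ B) s ρ k → OkCaseℕ N z s ρ k → costCaseℕ z s ρ k ≤ staticCost N z + staticCost N s
  costCaseℕ≤ z s ρ zero    ok = m≤n⇒m≤n+o _ (cost≤ z ρ ok)
  costCaseℕ≤ z s ρ (suc k) ok = m≤n⇒m≤o+n _ (cost≤ s _ ok)

  costCaseL≤ : ∀ {N} (z : Tm Γ B) (s : Tm (A′ ∷ list A′ ∷ Γ) B) ρ xs → OkCaseL N z s ρ xs →
               costCaseL z s ρ xs ≤ staticCost N z + staticCost N s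
  costCaseL≤ z s ρ []       ok = m≤n⇒m≤n+o _ (cost≤ z ρ ok)
  costCaseL≤ z s ρ (x ∷ xs) ok = m≤n⇒m≤o+n _ (cost≤ s _ ok)

  costRecℕ≤ : ∀ {N} (z : Tm Γ B) s ρ k → OkRecℕ N z s ρ k → costRecℕ z s ρ k ≤ staticCost N z + k * staticCost N s
  costRecℕ≤ z s ρ zero    ok = m≤n⇒m≤n+o 0 (cost≤ z ρ ok)
  costRecℕ≤ {N = N} z s ρ (suc k) (ok₁ , ok₂) = ≤-trans
    (+-mono-≤ (costRecℕ≤ z s ρ k ok₁) (cost≤ s _ ok₂))
    (≤-reflexive (trans (+-assoc (staticCost N z) _ _) (cong (staticCost N z +_) (+-comm (k * staticCost N s) _))))

  costRecL≤ : ∀ {N} (z : Tm Γ B) (s : Tm (B ∷ A′ ∷ list A′ ∷ Γ) B) ρ xs → OkRecL N z s ρ xs →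
              costRecL z s ρ xs ≤ staticCost N z + length xs * staticCost N s
  costRecL≤ z s ρ []       ok = m≤n⇒m≤n+o 0 (cost≤ z ρ ok)
  costRecL≤ {N = N} z s ρ (x ∷ xs) (ok₁ , ok₂) = ≤-trans
    (+-mono-≤ (costRecL≤ z s ρ xs ok₁) (cost≤ s _ ok₂))
    (≤-reflexive (trans (+-assoc (staticCost N z) _ _) (cong (staticCost N z +_) (+-comm (length xs * staticCost N s) _))))

-- Polynomially bounded functions

Polynomial : (ℕ → ℕ) → Set
Polynomial f = ∃[ k ] ∃[ d ] (∀ N → 0 < N → f N ≤ k * N ^ d)

const-polynomial : ∀ k → Polynomial (λ _ → k)
const-polynomial k = k , 0 , λ N _ → ≤-reflexive (sym (*-identityʳ k))

id-polynomial : Polynomial (λ N → N)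
id-polynomial = 1 , 1 , λ N _ → ≤-reflexive (sym (trans (*-identityˡ _) (*-identityʳ N)))

^-monoʳ : ∀ {N} d e → 0 < N → N ^ d ≤ N ^ (d + e)
^-monoʳ {N} d e 0<N = ^-monoʳ-≤ N {{>-nonZero 0<N}} (m≤m+n d e)

-- Powers of a positive N grow with the exponent, so both terms can be raised to the common degree
-- `d + e`.
+-polynomial : ∀ {f g} → Polynomial f → Polynomial g → Polynomial (λ N → f N + g N)
+-polynomial {f} {g} (k , d , f≤) (l , e , g≤) = k + l , d + e , λ N 0<N → begin
  f N + g N                              ≤⟨ +-mono-≤ (f≤ N 0<N) (g≤ N 0<N) ⟩
  k * N ^ d + l * N ^ e                  ≤⟨ +-mono-≤ (*-monoʳ-≤ k (^-monoʳ d e 0<N))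
                                                     (*-monoʳ-≤ l (subst (λ i → N ^ e ≤ N ^ i) (+-comm e d) (^-monoʳ e d 0<N))) ⟩
  k * N ^ (d + e) + l * N ^ (d + e)      ≡⟨ *-distribʳ-+ (N ^ (d + e)) k l ⟨
  (k + l) * N ^ (d + e)                  ∎
  where open ≤-Reasoning

*-polynomial : ∀ {f g} → Polynomial f → Polynomial g → Polynomial (λ N → f N * g N)
*-polynomial {f} {g} (k , d , f≤) (l , e , g≤) = k * l , d + e , λ N 0<N → begin
  f N * g N                  ≤⟨ *-mono-≤ (f≤ N 0<N) (g≤ N 0<N) ⟩
  k * N ^ d * (l * N ^ e)    ≡⟨ interchange *-commutativeSemigroup k (N ^ d) l (N ^ e) ⟩
  k * l * (N ^ d * N ^ e)    ≡⟨ cong (k * l *_) (^-distribˡ-+-* N d e) ⟨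
  k * l * N ^ (d + e)        ∎
  where open ≤-Reasoning

staticCost-polynomial : (t : Tm Γ B) → Polynomial (λ N → staticCost N t)
staticCost-polynomial = poly
  where
  1+ : ∀ {f} → Polynomial f → Polynomial (λ N → suc (f N))
  1+ = +-polynomial (const-polynomial 1)
  poly : ∀ {Γ B} (t : Tm Γ B) → Polynomial (λ N → staticCost N t)
  poly (var x)       = const-polynomial 1
  poly (let′ t b)    = 1+ (+-polynomial (poly t) (poly b))
  poly (call b t)    = 1+ (+-polynomial (poly t) (poly b))
  poly zero′         = const-polynomial 1
  poly (suc′ t)      = 1+ (poly t)
  poly (caseℕ t z s) = 1+ (+-polynomial (poly t) (+-polynomial (poly z) (poly s)))
  poly (recℕ t z s)  = 1+ (+-polynomial (poly t) (+-polynomial (poly z) (*-polynomial id-polynomial (poly s))))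
  poly (pair t u)    = 1+ (+-polynomial (poly t) (poly u))
  poly (fst t)       = 1+ (poly t)
  poly (snd t)       = 1+ (poly t)
  poly nil           = const-polynomial 1
  poly (cons t u)    = 1+ (+-polynomial (poly t) (poly u))
  poly (caseL t z s) = 1+ (+-polynomial (poly t) (+-polynomial (poly z) (poly s)))
  poly (recL t z s)  = 1+ (+-polynomial (poly t) (+-polynomial (poly z) (*-polynomial id-polynomial (poly s))))

-- Rules for loops and case distinctions

module _ {N : ℕ} {z : Tm Γ B} {s : Tm (B ∷ nat ∷ Γ) B} {ρ : Env Γ} where

  -- Whether the body stays within its bounds can depend on the accumulated value, so both claims go
  -- through one induction. The final invariant is returned because an enclosing loop needs it.
  okRecℕ-invariant : ∀ n (I : ℕ → Val B → Set) → Ok N z ρ → I 0 (eval z ρ) →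
    (∀ m r → m < n → I m r → Ok N s (r ∷ m ∷ ρ) × I (suc m) (eval s (r ∷ m ∷ ρ))) →
    OkRecℕ N z s ρ n × I n (primℕ (eval z ρ) (λ r m → eval s (r ∷ m ∷ ρ)) n)
  okRecℕ-invariant n I okz Iz oks = go n ≤-refl
    where
    go : ∀ k → k ≤ n → OkRecℕ N z s ρ k × I k (primℕ (eval z ρ) (λ r m → eval s (r ∷ m ∷ ρ)) k)
    go zero    _   = okz , Iz
    go (suc k) k<n with go k (<⇒≤ k<n)
    ... | ok , Ik with oks k _ k<n Ik
    ...   | ok′ , I′ = (ok , ok′) , I′

  okRecℕ : ∀ n → Ok N z ρ → (∀ m r → m < n → Ok N s (r ∷ m ∷ ρ)) → OkRecℕ N z s ρ n
  okRecℕ n okz oks = proj₁ (okRecℕ-invariant n (λ _ _ → ⊤) okz _ λ m r m<n _ → oks m r m<n , _)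

module _ {N : ℕ} {z : Tm Γ B} {s : Tm (B ∷ A′ ∷ list A′ ∷ Γ) B} {ρ : Env Γ} where

  okRecL : ∀ xs (P : Val A′ → Set) → All P xs → Ok N z ρ →
           (∀ r y ys → P y → Ok N s (r ∷ y ∷ ys ∷ ρ)) → OkRecL N z s ρ xs
  okRecL _ P []         okz oks = okz
  okRecL _ P (px ∷ pxs) okz oks = okRecL _ P pxs okz oks , oks _ _ _ px

primℕ-unique : ∀ {B : Set} {z : B} {s : B → ℕ → B} (f : ℕ → B) → z ≡ f 0 → (∀ n → s (f n) n ≡ f (suc n)) →
               ∀ n → primℕ z s n ≡ f n
primℕ-unique         f eqz eqs zero    = eqz
primℕ-unique {s = s} f eqz eqs (suc n) = trans (cong (λ r → s r n) (primℕ-unique f eqz eqs n)) (eqs n)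

primℕ-cong : ∀ {B : Set} {z z′ : B} {s s′ : B → ℕ → B} → z ≡ z′ → (∀ r m → s r m ≡ s′ r m) →
             ∀ n → primℕ z s n ≡ primℕ z′ s′ n
primℕ-cong {s′ = s′} eqz eqs = primℕ-unique (primℕ _ s′) eqz λ n → eqs _ n

primL-unique : ∀ {A B : Set} {z : B} {s : B → A → List A → B} (f : List A → B) → z ≡ f [] →
               (∀ x xs → s (f xs) x xs ≡ f (x ∷ xs)) → ∀ xs → primL z s xs ≡ f xs
primL-unique         f eqz eqs []       = eqz
primL-unique {s = s} f eqz eqs (x ∷ xs) = trans (cong (λ r → s r x xs) (primL-unique f eqz eqs xs)) (eqs x xs)

okCaseℕ : ∀ {N} {z : Tm Γ B} {s ρ} k → Ok N z ρ → (∀ j → Ok N s (j ∷ ρ)) → OkCaseℕ N z s ρ k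
okCaseℕ zero    okz oks = okz
okCaseℕ (suc k) okz oks = oks k

-- The successor branch is told that `k′` is `suc j`, because a program can recover the tested
-- number only from its predecessor, as `recolourP` does with `suc′ x₀`.
evalCaseℕ-if : ∀ {z : Tm Γ B} {s ρ k′ e t} k → k ≡ k′ → eval z ρ ≡ e → (∀ j → k′ ≡ suc j → eval s (j ∷ ρ) ≡ t) →
               evalCaseℕ z s ρ k ≡ if k′ t e
evalCaseℕ-if zero    refl eqz eqs = eqz
evalCaseℕ-if (suc k) refl eqz eqs = eqs k refl

-- The program

x₀ : ∀ {A} → Tm (A ∷ Γ) A
x₀ = var (here refl)

x₁ : ∀ {A A₀} → Tm (A₀ ∷ A ∷ Γ) A
x₁ = var (there (here refl))

x₂ : ∀ {A A₀ A₁} → Tm (A₀ ∷ A₁ ∷ A ∷ Γ) A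
x₂ = var (there (there (here refl)))

x₃ : ∀ {A A₀ A₁ A₂} → Tm (A₀ ∷ A₁ ∷ A₂ ∷ A ∷ Γ) A
x₃ = var (there (there (there (here refl))))

x₄ : ∀ {A A₀ A₁ A₂ A₃} → Tm (A₀ ∷ A₁ ∷ A₂ ∷ A₃ ∷ A ∷ Γ) A
x₄ = var (there (there (there (there (here refl)))))

Triple Triples : Ty
Triple  = nat ⊗ nat ⊗ nat
Triples = list Triple

opaque
  predP : Program nat nat
  predP = caseℕ x₀ zero′ x₀

  run-predP : ∀ k → run predP k ≡ k ∸ 1
  run-predP zero    = refl
  run-predP (suc k) = refl

  ok-predP : ∀ {N} k → Ok N predP (k ∷ [])
  ok-predP zero    = _
  ok-predP (suc k) = _

  subP : Program (nat ⊗ nat) nat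
  subP = recℕ (snd x₀) (fst x₀) (call predP x₀)

  run-subP : ∀ i j → run subP (i , j) ≡ i ∸ j
  run-subP i = primℕ-unique (i ∸_) refl λ j → trans (run-predP (i ∸ j)) (trans (∸-+-assoc i j 1) (cong (i ∸_) (+-comm j 1)))

  ok-subP : ∀ {N} i {j} → j ≤ N → Ok N subP ((i , j) ∷ [])
  ok-subP i {j} j≤N = _ , j≤N , okRecℕ j _ λ _ r _ → _ , ok-predP r

  addP : Program (nat ⊗ nat) nat
  addP = recℕ (snd x₀) (fst x₀) (suc′ x₀)

  run-addP : ∀ i j → run addP (i , j) ≡ i + j
  run-addP i = primℕ-unique (i +_) (sym (+-identityʳ i)) λ j → sym (+-suc i j)

  -- The recursion runs over the second summand only, so a running sum can be kept in the first
  -- place without any bound on its size.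
  ok-addP : ∀ {N} i {j} → j ≤ N → Ok N addP ((i , j) ∷ [])
  ok-addP i {j} j≤N = _ , j≤N , okRecℕ j _ _

  andP orP : Program (nat ⊗ nat) nat
  andP = caseℕ (fst x₀) zero′ (snd x₁)
  orP  = caseℕ (fst x₀) (snd x₀) (suc′ zero′)

  run-andP : ∀ i j → run andP (i , j) ≡ i and j
  run-andP zero    j = refl
  run-andP (suc i) j = refl

  ok-andP : ∀ {N} i j → Ok N andP ((i , j) ∷ [])
  ok-andP zero    j = _
  ok-andP (suc i) j = _

  run-orP : ∀ i j → run orP (i , j) ≡ i or j
  run-orP zero    j = refl
  run-orP (suc i) j = refl

  ok-orP : ∀ {N} i j → Ok N orP ((i , j) ∷ [])
  ok-orP zero    j = _
  ok-orP (suc i) j = _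

opaque
  eqP : Program (nat ⊗ nat) nat
  eqP = caseℕ (call subP x₀) (caseℕ (call subP (pair (snd x₀) (fst x₀))) (suc′ zero′) zero′) zero′

  run-eqP : ∀ i j → run eqP (i , j) ≡ δ i j
  run-eqP i j rewrite run-subP i j = go i j
    where
    go : ∀ i j → evalCaseℕ (caseℕ (call subP (pair (snd x₀) (fst x₀))) (suc′ zero′) zero′) zero′ ((i , j) ∷ []) (i ∸ j) ≡ δ i j
    go i j with i ∸ j in eq | δ i j | δ-test i j
    ... | zero  | _ | true refl rewrite run-subP i i | n∸n≡0 i = refl
    ... | zero  | _ | false i≢j rewrite run-subP j i with j ∸ i in eq′
    ...   | zero  = contradiction (≤-antisym (m∸n≡0⇒m≤n eq) (m∸n≡0⇒m≤n eq′)) i≢j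
    ...   | suc _ = refl
    go i j | suc _ | _ | true refl = contradiction (trans (sym (n∸n≡0 i)) eq) 0≢1+n
    go i j | suc _ | _ | false _   = refl

  ok-eqP : ∀ {N i j} → i ≤ N → j ≤ N → Ok N eqP ((i , j) ∷ [])
  ok-eqP {N} {i} {j} i≤N j≤N = (_ , ok-subP i j≤N) , outer (run subP (i , j))
    where
    inner : ∀ k → OkCaseℕ N (suc′ zero′) zero′ ((i , j) ∷ []) k
    inner zero    = _
    inner (suc _) = _
    outer : ∀ k → OkCaseℕ N (caseℕ (call subP (pair (snd x₀) (fst x₀))) (suc′ zero′) zero′) zero′ ((i , j) ∷ []) k
    outer zero    = (_ , ok-subP j i≤N) , inner (run subP (j , i))
    outer (suc _) = _

  triP : Program nat nat
  triP = recℕ x₀ zero′ (call addP (pair x₀ x₁))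

  run-triP : ∀ k → run triP k ≡ tri k
  run-triP = primℕ-unique tri refl λ k → run-addP (tri k) k

  ok-triP : ∀ {N k} → k ≤ N → Ok N triP (k ∷ [])
  ok-triP {k = k} k≤N = _ , k≤N , okRecℕ k _ λ m r m<k → _ , ok-addP r (≤-trans (<⇒≤ m<k) k≤N)

opaque
  memP : Program (nat ⊗ list nat) nat
  memP = recL (snd x₀) zero′ (call orP (pair (call eqP (pair (fst x₃) x₁)) x₀))

  run-memP : ∀ x F → run memP (x , F) ≡ mem x F
  run-memP x = primL-unique (mem x) refl λ y F →
    trans (run-orP _ (mem x F)) (cong (_or mem x F) (run-eqP x y))

  ok-memP : ∀ {N x F} → x ≤ N → length F ≤ N → All (_≤ N) F → Ok N memP ((x , F) ∷ [])
  ok-memP {N} {F = F} x≤N len all = _ , len , okRecL F (_≤ N) all _ λ r y ys y≤N →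
    ((_ , ok-eqP x≤N y≤N) , _) , ok-orP _ r

  joinsP : Program (nat ⊗ nat ⊗ nat ⊗ nat) nat
  joinsP = call orP (pair
    (call andP (pair (call eqP (pair a x)) (call eqP (pair b y))))
    (call andP (pair (call eqP (pair a y)) (call eqP (pair b x)))))
    where
    a b x y : Tm ((nat ⊗ nat ⊗ nat ⊗ nat) ∷ []) nat
    a = fst x₀
    b = fst (snd x₀)
    x = fst (snd (snd x₀))
    y = snd (snd (snd x₀))

  run-joinsP : ∀ a b x y → run joinsP (a , b , x , y) ≡ joins a b x y
  run-joinsP a b x y rewrite run-eqP a x | run-eqP b y | run-eqP a y | run-eqP b x
    | run-andP (δ a x) (δ b y) | run-andP (δ a y) (δ b x) = run-orP _ _

  ok-joinsP : ∀ {N a b x y} → a ≤ N → b ≤ N → x ≤ N → y ≤ N → Ok N joinsP ((a , b , x , y) ∷ [])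
  ok-joinsP a≤ b≤ x≤ y≤ =
    (((((_ , ok-eqP a≤ x≤) , (_ , ok-eqP b≤ y≤)) , ok-andP _ _)) ,
     ((((_ , ok-eqP a≤ y≤) , (_ , ok-eqP b≤ x≤)) , ok-andP _ _))) , ok-orP _ _

-- The colour of the edge xy plus one, or 0 if xy is not listed.
lookup : List (ℕ × ℕ × ℕ) → ℕ → ℕ → ℕ
lookup []                x y = 0
lookup ((a , b , k) ∷ L) x y = if (joins a b x y) (suc k) (lookup L x y)

-- The colour is bounded in the form `suc k`, because this is the number that `lookup` returns and
-- on which further programs recurse.
record Small (N : ℕ) (L : List (ℕ × ℕ × ℕ)) : Set where
  field
    length≤ : length L ≤ N
    entries : All (λ (a , b , k) → a ≤ N × b ≤ N × suc k ≤ N) L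

lookup≤ : ∀ {N L} → Small N L → ∀ x y → lookup L x y ≤ N
lookup≤ {N} {L} small x y = go L (Small.entries small)
  where
  go : ∀ L → All (λ (a , b , k) → a ≤ N × b ≤ N × suc k ≤ N) L → lookup L x y ≤ N
  go []                []                   = z≤n
  go ((a , b , k) ∷ L) ((_ , _ , k<N) ∷ all) with joins a b x y
  ... | zero  = go L all
  ... | suc _ = k<N

opaque
  lookupP : Program (Triples ⊗ nat ⊗ nat) nat
  lookupP = recL (fst x₀) zero′
    (caseℕ (call joinsP (pair (fst x₁) (pair (fst (snd x₁)) (snd x₃)))) x₀ (suc′ (snd (snd x₂))))

  run-lookupP : ∀ L x y → run lookupP (L , x , y) ≡ lookup L x y
  run-lookupP L x y = primL-unique (λ L → lookup L x y) refl
    (λ (a , b , k) L′ → evalCaseℕ-if (run joinsP (a , b , x , y)) (run-joinsP a b x y) refl λ _ _ → refl) L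

  ok-lookupP : ∀ {N L x y} → Small N L → x ≤ N → y ≤ N → Ok N lookupP ((L , x , y) ∷ [])
  ok-lookupP {L = L} {x} {y} small x≤ y≤ =
    _ , Small.length≤ small , okRecL L _ (Small.entries small) _ λ r (a , b , k) ys (a≤ , b≤ , _) →
      (_ , ok-joinsP a≤ b≤ x≤ y≤) , okCaseℕ (run joinsP (a , b , x , y)) _ _

opaque
  countP : Program (nat ⊗ Triples ⊗ nat ⊗ nat) nat
  countP = recℕ (fst x₀) zero′ (call addP (pair x₀
    (call eqP (pair (call lookupP (pair (fst (snd x₂)) (pair (fst (snd (snd x₂))) x₁)))
                    (suc′ (snd (snd (snd x₂))))))))

  run-countP : ∀ n L u μ → run countP (n , L , u , μ) ≡ count n (lookup L u) (suc μ)
  run-countP n L u μ = primℕ-unique (λ n → count n (lookup L u) (suc μ)) refl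
    (λ x → trans (run-addP _ _) (cong (count x (lookup L u) (suc μ) +_)
      (trans (run-eqP _ (suc μ)) (cong (λ k → δ k (suc μ)) (run-lookupP L u x))))) n

  ok-countP : ∀ {N n L u μ} → n ≤ N → Small N L → u ≤ N → suc μ ≤ N → Ok N countP ((n , L , u , μ) ∷ [])
  ok-countP {N} {n} {L} {u} {μ} n≤ small u≤ μ< = _ , n≤ , okRecℕ n _ λ x r x<n →
    (_ , (((_ , ok-lookupP small u≤ (≤-trans (<⇒≤ x<n) n≤)) , _) ,
       ok-eqP (subst (_≤ N) (sym (run-lookupP L u x)) (lookup≤ small u x)) μ<)) ,
     ok-addP r (subst (_≤ N) (sym (run-eqP _ (suc μ))) (≤-trans (δ≤1 (run lookupP (L , u , x)) (suc μ)) (≤-trans (s≤s z≤n) μ<)))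

opaque
  rowP : Program (nat ⊗ Triples ⊗ nat) nat
  rowP = recℕ (call predP (fst x₀)) zero′ (call addP (pair x₀ (call triP (call countP
    (pair (fst x₂) (pair (fst (snd x₂)) (pair (snd (snd x₂)) x₁)))))))

  run-rowP : ∀ n L u → run rowP (n , L , u) ≡ rowΨ n (lookup L u)
  run-rowP n L u = trans
    (primℕ-unique (λ m → ∑ m (λ μ → tri (count n (lookup L u) (suc μ)))) refl
      (λ μ → trans (run-addP _ _) (cong (∑ μ (λ μ → tri (count n (lookup L u) (suc μ))) +_)
        (trans (run-triP _) (cong tri (run-countP n L u μ))))) (run predP n))
    (cong (λ m → ∑ m (λ μ → tri (count n (lookup L u) (suc μ)))) (run-predP n))

  ok-rowP : ∀ {N n L u} → n ≤ N → n * n ≤ N → Small N L → u ≤ N → Ok N rowP ((n , L , u) ∷ [])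
  ok-rowP {N} {n} {L} {u} n≤ n²≤ small u≤ =
    (_ , ok-predP n) , subst (_≤ N) (sym (run-predP n)) pred≤N , okRecℕ (run predP n) _ λ μ r μ< →
      (_ , ((_ , ok-countP n≤ small u≤ (≤-trans μ< (subst (_≤ N) (sym (run-predP n)) pred≤N))) ,
          ok-triP (subst (_≤ N) (sym (run-countP n L u μ)) (≤-trans (count≤ n (lookup L u) (suc μ)) n≤)))) ,
        -- The second summand is a single triangular number, which can be quadratic in n; hence the
        -- hypothesis `n * n ≤ N`.
        ok-addP r (begin
          run triP (run countP (n , L , u , μ))      ≡⟨ trans (run-triP _) (cong tri (run-countP n L u μ)) ⟩
          tri (count n (lookup L u) (suc μ))         ≤⟨ tri≤ (count≤ n (lookup L u) (suc μ)) ⟩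
          count n (lookup L u) (suc μ) * n           ≤⟨ *-monoˡ-≤ n (count≤ n (lookup L u) (suc μ)) ⟩
          n * n                                      ≤⟨ n²≤ ⟩
          N                                          ∎)
    where
    open ≤-Reasoning
    pred≤N : n ∸ 1 ≤ N
    pred≤N = ≤-trans (m∸n≤m n 1) n≤

opaque
  psiP : Program (nat ⊗ Triples) nat
  psiP = recℕ (fst x₀) zero′ (call addP (pair x₀ (call rowP (pair (fst x₂) (pair (snd x₂) x₁)))))

  run-psiP : ∀ n L → run psiP (n , L) ≡ matrixΨ n (lookup L)
  run-psiP n L = primℕ-unique (λ m → ∑ m (λ u → rowΨ n (lookup L u))) refl
    (λ u → trans (run-addP _ _) (cong (∑ u (λ u → rowΨ n (lookup L u)) +_) (run-rowP n L u))) n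

  ok-psiP : ∀ {N n L} → n ≤ N → n * n ≤ N → Small N L → Ok N psiP ((n , L) ∷ [])
  ok-psiP {N} {n} {L} n≤ n²≤ small = _ , n≤ , okRecℕ n _ λ u r u<n →
    (_ , (_ , ok-rowP n≤ n²≤ small (≤-trans (<⇒≤ u<n) n≤))) ,
      ok-addP r (subst (_≤ N) (sym (run-rowP n L u)) (≤-trans (rowΨ≤ n (lookup L u)) n²≤))

Move : Ty
Move = Triples ⊗ nat ⊗ nat ⊗ nat ⊗ nat

opaque
  recolourP : Program (Move ⊗ nat ⊗ nat) nat
  recolourP = caseℕ (call lookupP (pair (fst (fst x₀)) (snd x₀))) zero′
    (caseℕ (call joinsP (pair (fst (snd (fst x₁))) (pair (fst (snd (snd (fst x₁)))) (snd x₁))))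
      (suc′ x₀) (suc′ (snd (snd (snd (snd (fst x₂)))))))

  run-recolourP : ∀ L v w u ν x y → run recolourP ((L , v , w , u , ν) , x , y) ≡ recolour (lookup L) v w ν x y
  run-recolourP L v w u ν x y = evalCaseℕ-if (run lookupP (L , x , y)) (run-lookupP L x y) refl
    λ j eq → evalCaseℕ-if (run joinsP (v , w , x , y)) (run-joinsP v w x y) (sym eq) λ _ _ → refl

  ok-recolourP : ∀ {N L v w u ν x y} → Small N L → v ≤ N → w ≤ N → x ≤ N → y ≤ N →
                 Ok N recolourP (((L , v , w , u , ν) , x , y) ∷ [])
  ok-recolourP {L = L} {v} {w} {x = x} {y} small v≤ w≤ x≤ y≤ =
    (_ , ok-lookupP small x≤ y≤) , okCaseℕ (run lookupP (L , x , y)) _ λ j →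
      (_ , ok-joinsP v≤ w≤ x≤ y≤) , okCaseℕ (run joinsP (v , w , x , y)) _ _

opaque
  stepP : Program (Move ⊗ nat ⊗ nat ⊗ list nat) (nat ⊗ list nat)
  stepP = caseℕ (call eqP (pair (call recolourP (pair q₀ (pair (fst (snd (snd q₀))) (fst (snd x₀))))) (fst (snd (snd x₀)))))
    (snd (snd x₀))
    (caseℕ (call memP (pair (fst (snd x₁)) (snd (snd (snd x₁)))))
      (caseℕ (call recolourP (pair (fst x₁) (pair (fst (snd (snd (snd (fst x₁))))) (fst (snd x₁)))))
        (snd (snd x₁))
        (pair (suc′ x₀) (cons (fst (snd x₂)) (snd (snd (snd x₂))))))
      (snd (snd x₂)))
    where
    q₀ : Tm ((Move ⊗ nat ⊗ nat ⊗ list nat) ∷ []) Move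
    q₀ = fst x₀

  run-stepP : ∀ n L v w u ν x s →
    run stepP ((L , v , w , u , ν) , x , s) ≡ Walk.visit n (recolour (lookup L) v w ν) w u x s
  run-stepP n L v w u ν x s = evalCaseℕ-if _
    (trans (run-eqP _ (proj₁ s)) (cong (λ k → δ k (proj₁ s)) (run-recolourP L v w u ν w x))) refl
    λ _ _ → evalCaseℕ-if (run memP (x , proj₂ s)) (run-memP x (proj₂ s))
      (advance (run recolourP ((L , v , w , u , ν) , u , x)) (run-recolourP L v w u ν u x) refl λ _ → refl)
      λ _ _ → refl
    where
    advance : ∀ {z : Tm Γ (nat ⊗ list nat)} {t ρ k′} k → k ≡ k′ → eval z ρ ≡ s →
      (∀ j → eval t (j ∷ ρ) ≡ (suc j , x ∷ proj₂ s)) →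
      evalCaseℕ z t ρ k ≡ Walk.advance n (recolour (lookup L) v w ν) w u k′ x s
    advance zero    refl eqz eqs = eqz
    advance (suc k) refl eqz eqs = eqs k

  ok-stepP : ∀ {N L v w u ν x s} → Small N L → (∀ x y → recolour (lookup L) v w ν x y ≤ N) →
    v ≤ N → w ≤ N → u ≤ N → x ≤ N → proj₁ s ≤ N → length (proj₂ s) ≤ N → All (_≤ N) (proj₂ s) →
    Ok N stepP (((L , v , w , u , ν) , x , s) ∷ [])
  ok-stepP {N} {L} {v} {w} {u} {ν} {x} {s} small range v≤ w≤ u≤ x≤ κ≤ len all =
    ((((_ , ok-recolourP small v≤ w≤ w≤ x≤) , _) ,
       ok-eqP (subst (_≤ N) (sym (run-recolourP L v w u ν w x)) (range w x)) κ≤)) ,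
    okCaseℕ (run eqP (run recolourP ((L , v , w , u , ν) , w , x) , proj₁ s)) _ λ _ →
      (_ , ok-memP x≤ len all) , okCaseℕ (run memP (x , proj₂ s))
        ((_ , ok-recolourP small v≤ w≤ u≤ x≤) , okCaseℕ (run recolourP ((L , v , w , u , ν) , u , x)) _ _)
        _

record Valid (N n : ℕ) (L : List (ℕ × ℕ × ℕ)) (v w u ν : ℕ) : Set where
  field
    n≤N       : n ≤ N
    n²≤N      : n * n ≤ N
    small     : Small N L
    colouring : EdgeColouring n (lookup L)
    v<n       : v < n
    w<n       : w < n
    u<n       : u < n
    ν<n∸1     : ν < n ∸ 1

  <⇒≤N : ∀ {x} → x < n → x ≤ N
  <⇒≤N x<n = ≤-trans (<⇒≤ x<n) n≤N

  v≤N : v ≤ N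
  v≤N = <⇒≤N v<n
  w≤N : w ≤ N
  w≤N = <⇒≤N w<n
  u≤N : u ≤ N
  u≤N = <⇒≤N u<n

  recoloured : EdgeColouring n (recolour (lookup L) v w ν)
  recoloured = recolour-edgeColouring v w colouring ν<n∸1

  recoloured≤N : ∀ x y → recolour (lookup L) v w ν x y ≤ N
  recoloured≤N x y = ≤-trans (EdgeColouring.range recoloured x y) (≤-trans (m∸n≤m n 1) n≤N)

  module W = Walk n (recolour (lookup L) v w ν) w u

  WalkState : State → Set
  WalkState s = proj₁ s ≤ N × length (proj₂ s) ≤ N × All (_≤ N) (proj₂ s)

  -- The used columns are distinct and lie below n, so the list never has more than n entries.
  walkState : ∀ {s} → W.Invariant (suc ν) s → WalkState s
  walkState {κ , F} inv =
    ≤-trans head-range (≤-trans (m∸n≤m n 1) n≤N) ,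
    ≤-trans (≤-reflexive card) (≤-trans (∑-mem≤ n F) n≤N) ,
    All.map <⇒≤N bounded
    where open W.Invariant inv

  finalState : WalkState (W.walk (suc ν))
  finalState = walkState (W.walk-invariant (suc ν) (EdgeColouring.range recoloured) z<s ν<n∸1)

opaque
  walkP : Program (nat ⊗ Move) (nat ⊗ list nat)
  walkP = recℕ (fst x₀) (pair (suc′ (snd (snd (snd (snd (snd x₀)))))) nil)
    (recℕ (fst x₂) x₀ (call stepP (pair (snd x₄) (pair x₁ x₀))))

  run-walkP : ∀ n L v w u ν →
    run walkP (n , L , v , w , u , ν) ≡ Walk.walk n (recolour (lookup L) v w ν) w u (suc ν)
  run-walkP n L v w u ν = primℕ-cong refl
    (λ s _ → primℕ-cong refl (λ s x → run-stepP n L v w u ν x s) n) n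

  ok-walkP : ∀ {N n L v w u ν} → Valid N n L v w u ν → Ok N walkP ((n , L , v , w , u , ν) ∷ [])
  ok-walkP {N} {n} {L} {v} {w} {u} {ν} valid =
    _ , n≤N , proj₁ (okRecℕ-invariant n (λ _ → W.Invariant (suc ν)) _ (W.initial (suc ν) z<s ν<n∸1)
      λ i s i<n inv →
        let inner = okRecℕ-invariant n (λ _ → W.Invariant (suc ν)) _ inv λ x r x<n inv′ →
              (_ , ok-step x<n inv′) , step-inv x<n inv′
        in (_ , n≤N , proj₁ inner) , proj₂ inner)
    where
    open Valid valid
    ok-step : ∀ {x s} → x < n → W.Invariant (suc ν) s → Ok N stepP (((L , v , w , u , ν) , x , s) ∷ [])
    ok-step x<n inv with walkState inv
    ... | κ≤ , len , all = ok-stepP small recoloured≤N v≤N w≤N u≤N (<⇒≤N x<n) κ≤ len all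
    step-inv : ∀ {x s} → x < n → W.Invariant (suc ν) s → W.Invariant (suc ν) (run stepP ((L , v , w , u , ν) , x , s))
    step-inv {x} {s} x<n inv = subst (W.Invariant (suc ν)) (sym (run-stepP n L v w u ν x s))
      (W.visit-invariant (suc ν) (EdgeColouring.range recoloured) x x<n inv)

opaque
  τP : Program (nat ⊗ nat ⊗ list nat ⊗ nat ⊗ nat) nat
  τP = caseℕ (call memP (pair (fst (snd (snd (snd x₀)))) (fst (snd (snd x₀)))))
    (snd (snd (snd (snd x₀))))
    (caseℕ (call eqP (pair (snd (snd (snd (snd x₁)))) (fst x₁)))
      (caseℕ (call eqP (pair (snd (snd (snd (snd x₁)))) (fst (snd x₁)))) (snd (snd (snd (snd x₁)))) (fst x₂))
      (fst (snd x₂)))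

  run-τP : ∀ w u F x y → run τP (w , u , F , x , y) ≡ if (mem x F) (σ w u y) y
  run-τP w u F x y = evalCaseℕ-if (run memP (x , F)) (run-memP x F) refl
    λ _ _ → evalCaseℕ-if (run eqP (y , w)) (run-eqP y w)
      (evalCaseℕ-if (run eqP (y , u)) (run-eqP y u) refl λ _ _ → refl)
      λ _ _ → refl

  ok-τP : ∀ {N w u F x y} → w ≤ N → u ≤ N → x ≤ N → y ≤ N → length F ≤ N → All (_≤ N) F →
          Ok N τP ((w , u , F , x , y) ∷ [])
  ok-τP {w = w} {u} {F} {x} {y} w≤ u≤ x≤ y≤ len all =
    (_ , ok-memP x≤ len all) , okCaseℕ (run memP (x , F)) _ λ _ →
      (_ , ok-eqP y≤ w≤) , okCaseℕ (run eqP (y , w))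
        ((_ , ok-eqP y≤ u≤) , okCaseℕ (run eqP (y , u)) _ _)
        _

  τ≤ : ∀ {N w u F x y} → w ≤ N → u ≤ N → y ≤ N → run τP (w , u , F , x , y) ≤ N
  τ≤ {N} {w} {u} {F} {x} {y} w≤ u≤ y≤ = subst (_≤ N) (sym (run-τP w u F x y)) (go (mem x F) (δ y w) (δ y u))
    where
    go : ∀ i j k → if i (if j u (if k w y)) y ≤ N
    go zero    j       k       = y≤
    go (suc i) zero    zero    = y≤
    go (suc i) zero    (suc k) = w≤
    go (suc i) (suc j) k       = u≤

opaque
  exchangeP : Program (Move ⊗ list nat ⊗ nat ⊗ nat) nat
  exchangeP = call recolourP (pair (fst x₀) (pair
    (call τP (pair w (pair u (pair F (pair y x)))))
    (call τP (pair w (pair u (pair F (pair x y)))))))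
    where
    w u x y : Tm ((Move ⊗ list nat ⊗ nat ⊗ nat) ∷ []) nat
    w = fst (snd (snd (fst x₀)))
    u = fst (snd (snd (snd (fst x₀))))
    x = fst (snd (snd x₀))
    y = snd (snd (snd x₀))
    F : Tm ((Move ⊗ list nat ⊗ nat ⊗ nat) ∷ []) (list nat)
    F = fst (snd x₀)

  run-exchangeP : ∀ L v w u ν F x y →
    run exchangeP ((L , v , w , u , ν) , F , x , y) ≡ exchange (recolour (lookup L) v w ν) w u F x y
  run-exchangeP L v w u ν F x y = trans (run-recolourP L v w u ν _ _)
    (cong₂ (recolour (lookup L) v w ν) (run-τP w u F y x) (run-τP w u F x y))

  ok-exchangeP : ∀ {N L v w u ν F x y} → Small N L → v ≤ N → w ≤ N → u ≤ N → x ≤ N → y ≤ N →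
    length F ≤ N → All (_≤ N) F → Ok N exchangeP (((L , v , w , u , ν) , F , x , y) ∷ [])
  ok-exchangeP {F = F} {x} {y} small v≤ w≤ u≤ x≤ y≤ len all =
    (_ , (_ , ok-τP w≤ u≤ y≤ x≤ len all) , (_ , ok-τP w≤ u≤ x≤ y≤ len all)) ,
    ok-recolourP small v≤ w≤ (τ≤ {F = F} {y} w≤ u≤ x≤) (τ≤ {F = F} {x} w≤ u≤ y≤)

-- Trying all candidates

move : ℕ → List (ℕ × ℕ × ℕ) → ℕ → ℕ → ℕ → ℕ → List (ℕ × ℕ × ℕ)
-- A triple stores the colour itself, whereas a matrix stores the colour plus one.
move n L v w u ν = map (λ (a , b , _) → a , b , candidate n (lookup L) v w u ν a b ∸ 1) L

-- The truncated difference is nonzero exactly when the candidate beats the best list `B` found so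
-- far.
attempt : ℕ → List (ℕ × ℕ × ℕ) → ℕ → ℕ → ℕ → ℕ → List (ℕ × ℕ × ℕ) → List (ℕ × ℕ × ℕ)
attempt n L v w u ν B =
  if (matrixΨ n (lookup B) ∸ matrixΨ n (lookup (move n L v w u ν))) (move n L v w u ν) B

-- Every candidate is built from the input `L` and never from the current best `B`, so the outcome
-- stays a single move away from the input however often `B` is replaced.
search : ℕ → List (ℕ × ℕ × ℕ) → List (ℕ × ℕ × ℕ)
search n L =
  primℕ L (λ B v → primℕ B (λ B w → primℕ B (λ B u → primℕ B (λ B ν →
    attempt n L v w u ν B) (n ∸ 1)) n) n) n

opaque
  moveP : Program (nat ⊗ Move) Triples
  moveP = let′ (snd (call walkP x₀)) (recL (fst (snd x₁)) nil
    (cons (pair (fst x₁) (pair (fst (snd x₁)) (call predP (call exchangeP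
            (pair (snd x₄) (pair x₃ (pair (fst x₁) (fst (snd x₁)))))))))
          x₀))

  run-moveP : ∀ n L v w u ν → run moveP (n , L , v , w , u , ν) ≡ move n L v w u ν
  run-moveP n L v w u ν = primL-unique
    (map (λ (a , b , _) → a , b , candidate n (lookup L) v w u ν a b ∸ 1)) refl
    (λ (a , b , _) xs → cong (λ k → (a , b , k) ∷ _) (trans (run-predP _) (cong (_∸ 1)
      (trans (run-exchangeP L v w u ν _ a b)
             (cong (λ s → exchange (recolour (lookup L) v w ν) w u (proj₂ s) a b) (run-walkP n L v w u ν))))))
    L

  ok-moveP : ∀ {N n L v w u ν} → Valid N n L v w u ν → Ok N moveP ((n , L , v , w , u , ν) ∷ [])
  ok-moveP {N} {n} {L} {v} {w} {u} {ν} valid with subst WalkState (sym (run-walkP n L v w u ν)) finalState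
    where open Valid valid
  ... | _ , len , all = (_ , ok-walkP valid) , _ , Small.length≤ small ,
    okRecL L _ (Small.entries small) _ λ r (a , b , k) xs (a≤ , b≤ , _) →
      (_ , _ , (_ , ok-exchangeP small v≤N w≤N u≤N a≤ b≤ len all) ,
        ok-predP (run exchangeP ((L , v , w , u , ν) , proj₂ (run walkP (n , L , v , w , u , ν)) , a , b))) , _
    where open Valid valid

opaque
  attemptP : Program (nat ⊗ Move ⊗ Triples) Triples
  attemptP = let′ (call moveP (pair (fst x₀) (fst (snd x₀))))
    (caseℕ (call subP (pair (call psiP (pair (fst x₁) (snd (snd x₁)))) (call psiP (pair (fst x₁) x₀))))
      (snd (snd x₁)) x₁)

  run-attemptP : ∀ n L v w u ν B → run attemptP (n , (L , v , w , u , ν) , B) ≡ attempt n L v w u ν B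
  run-attemptP n L v w u ν B = trans
    (evalCaseℕ-if (run subP (run psiP (n , B) , run psiP (n , new)))
      (trans (run-subP _ _) (cong₂ _∸_ (run-psiP n B) (run-psiP n new))) refl λ _ _ → refl)
    (cong (λ new → if (matrixΨ n (lookup B) ∸ matrixΨ n (lookup new)) new B) (run-moveP n L v w u ν))
    where
    new : List (ℕ × ℕ × ℕ)
    new = run moveP (n , L , v , w , u , ν)

  ok-attemptP : ∀ {N n L v w u ν B} → Valid N n L v w u ν → n * (n * n) ≤ N → Small N B → Small N (move n L v w u ν) →
    Ok N attemptP ((n , (L , v , w , u , ν) , B) ∷ [])
  ok-attemptP {N} {n} {L} {v} {w} {u} {ν} {B} valid n³≤ smallB small′ =
    (_ , ok-moveP valid) ,
    ((((_ , ok-psiP n≤N n²≤N smallB) , (_ , ok-psiP n≤N n²≤N (subst (Small N) (sym (run-moveP n L v w u ν)) small′))) ,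
      ok-subP _ (subst (_≤ N) (sym (run-psiP n new)) (≤-trans (matrixΨ≤ n (lookup new)) n³≤))) ,
     okCaseℕ (run subP (run psiP (n , B) , run psiP (n , new))) _ _)
    where
    open Valid valid
    new : List (ℕ × ℕ × ℕ)
    new = run moveP (n , L , v , w , u , ν)

attempt-preserves : ∀ (P : List (ℕ × ℕ × ℕ) → Set) n L v w u ν {B} → P B → P (move n L v w u ν) → P (attempt n L v w u ν B)
attempt-preserves P n L v w u ν {B} PB Pnew with matrixΨ n (lookup B) ∸ matrixΨ n (lookup (move n L v w u ν))
... | zero  = PB
... | suc _ = Pnew

opaque
  searchP : Program (nat ⊗ Triples) (nat ⊗ Triples)
  searchP = pair (fst x₀) (recℕ (fst x₀) (snd x₀) (recℕ (fst x₂) x₀ (recℕ (fst x₄) x₀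
    (recℕ (call predP (fst (var (there (there x₄∈))))) x₀
      (call attemptP (pair (fst arg) (pair
        (pair (snd arg) (pair (var (there (there (there x₄∈)))) (pair (var (there x₄∈)) (pair x₃ x₁))))
        x₀)))))))
    where
    x₄∈ : ∀ {A A₀ A₁ A₂ A₃} → A ∈ (A₀ ∷ A₁ ∷ A₂ ∷ A₃ ∷ A ∷ Γ)
    x₄∈ = there (there (there (there (here refl))))
    arg : ∀ {A A₀ A₁ A₂ A₃ A₄ A₅ A₆ A₇} → Tm (A₀ ∷ A₁ ∷ A₂ ∷ A₃ ∷ A₄ ∷ A₅ ∷ A₆ ∷ A₇ ∷ A ∷ Γ) A
    arg = var (there (there (there (there x₄∈))))

  run-searchP : ∀ n L → run searchP (n , L) ≡ (n , search n L)
  run-searchP n L = cong (n ,_)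
    (primℕ-cong refl (λ B v → primℕ-cong refl (λ B w → primℕ-cong refl (λ B u →
      trans (cong (primℕ B _) (run-predP n))
            (primℕ-cong refl (λ B ν → run-attemptP n L v w u ν B) (n ∸ 1))) n) n) n)

  -- The best list found so far is handed to `psiP` again and again, so its smallness has to be
  -- carried through all four loops.
  ok-searchP : ∀ {N n L} → n ≤ N → n * n ≤ N → n * (n * n) ≤ N → Small N L → EdgeColouring n (lookup L) →
    (∀ {v w u ν} → v < n → w < n → u < n → ν < n ∸ 1 → Small N (move n L v w u ν)) →
    Ok N searchP ((n , L) ∷ [])
  ok-searchP {N} {n} {L} n≤N n²≤N n³≤N small col small′ =
    _ , _ , n≤N , proj₁ (okRecℕ-invariant n (λ _ → Small N) _ small λ v B₀ v<n small₀ →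
      let w-loop = okRecℕ-invariant n (λ _ → Small N) _ small₀ λ w B₁ w<n small₁ →
            let u-loop = okRecℕ-invariant n (λ _ → Small N) _ small₁ λ u B₂ u<n small₂ →
                  let ν-loop = okRecℕ-invariant (run predP n) (λ _ → Small N) _ small₂ λ ν B₃ ν< small₃ →
                        let move-valid = valid v<n w<n u<n ν<
                            new   = small′ v<n w<n u<n (subst (ν <_) (run-predP n) ν<)
                        in (_ , ok-attemptP move-valid n³≤N small₃ new) ,
                           subst (Small N) (sym (run-attemptP n L v w u ν B₃)) (attempt-preserves (Small N) n L v w u ν small₃ new)
                  in ((_ , ok-predP n) , pred≤N , proj₁ ν-loop) , proj₂ ν-loop
            in (_ , n≤N , proj₁ u-loop) , proj₂ u-loop
      in (_ , n≤N , proj₁ w-loop) , proj₂ w-loop)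
    where
    pred≤N : run predP n ≤ N
    pred≤N = subst (_≤ N) (sym (run-predP n)) (≤-trans (m∸n≤m n 1) n≤N)
    valid : ∀ {v w u ν} → v < n → w < n → u < n → ν < run predP n → Valid N n L v w u ν
    valid {ν = ν} v<n w<n u<n ν< = record
      { n≤N = n≤N ; n²≤N = n²≤N ; small = small ; colouring = col
      ; v<n = v<n ; w<n = w<n ; u<n = u<n ; ν<n∸1 = subst (ν <_) (run-predP n) ν< }

-- Colourings of the complete graph as matrices

private variable
  n : ℕ

triples : Coloring n → List (ℕ × ℕ × ℕ)
triples C = proj₂ (encode C)

matrix : Coloring n → ℕ → ℕ → ℕ
matrix C = lookup (triples C)

ordered : (e : Edge n) → lo e Fin.< hi e
ordered (edge u v u<v) = recompute (u Fin.<? v) u<v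

∈-edges : (e : Edge n) → e ∈ edges n
∈-edges {n} e@(edge u v _) = Any.mapMaybe⁺ mkEdge _ (Any.map⁺ (Any.map listed (∈-cartesianProduct⁺ (∈-allFin u) (∈-allFin v))))
  where
  listed : ∀ {p} → (u , v) ≡ p → Maybe.Any (e ≡_) (mkEdge p)
  listed refl with u Fin.<? v
  ... | yes _   = Maybe.just refl
  ... | no  u≮v = contradiction (ordered e) u≮v

length-cartesianProduct : ∀ {A B : Set} (xs : List A) (ys : List B) →
  length (cartesianProduct xs ys) ≡ length xs * length ys
length-cartesianProduct []       ys = refl
length-cartesianProduct (x ∷ xs) ys = trans (length-++ (map (x ,_) ys))
  (cong₂ _+_ (length-map (x ,_) ys) (length-cartesianProduct xs ys))

length-edges : ∀ n → length (edges n) ≤ n * n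
length-edges n = begin
  length (edges n)                               ≤⟨ length-mapMaybe mkEdge (cartesianProduct (allFin n) (allFin n)) ⟩
  length (cartesianProduct (allFin n) (allFin n)) ≡⟨ length-cartesianProduct (allFin n) (allFin n) ⟩
  length (allFin n) * length (allFin n)          ≡⟨ cong (λ k → k * k) (length-tabulate {n = n} id) ⟩
  n * n                                          ∎
  where open ≤-Reasoning

edge-between : ∀ {x y} → x < n → y < n → x ≢ y →
  ∃[ e ] ((x ≡ toℕ (lo {n} e) × y ≡ toℕ (hi e)) ⊎ (x ≡ toℕ (hi e) × y ≡ toℕ (lo e)))
edge-between {x = x} {y} x<n y<n x≢y with x <? y
... | yes x<y = edge (fromℕ< x<n) (fromℕ< y<n) (subst₂ _<_ (sym (Fin.toℕ-fromℕ< x<n)) (sym (Fin.toℕ-fromℕ< y<n)) x<y) ,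
                inj₁ (sym (Fin.toℕ-fromℕ< x<n) , sym (Fin.toℕ-fromℕ< y<n))
... | no  x≮y = edge (fromℕ< y<n) (fromℕ< x<n) (subst₂ _<_ (sym (Fin.toℕ-fromℕ< y<n)) (sym (Fin.toℕ-fromℕ< x<n))
                                                  (≤∧≢⇒< (≮⇒≥ x≮y) (x≢y ∘ sym))) ,
                inj₂ (sym (Fin.toℕ-fromℕ< x<n) , sym (Fin.toℕ-fromℕ< y<n))

lookup-sym : ∀ L x y → lookup L x y ≡ lookup L y x
lookup-sym []                x y = refl
lookup-sym ((a , b , k) ∷ L) x y =
  cong₂ (λ i j → if i (suc k) j) (joins-sym a b x y) (lookup-sym L x y)

module _ (C : Coloring n) where

  private
    triple : Edge n → ℕ × ℕ × ℕ
    triple e = toℕ (lo e) , toℕ (hi e) , toℕ (C e)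

  lookup-diagonal : ∀ es x → lookup (map triple es) x x ≡ 0
  lookup-diagonal []       x = refl
  lookup-diagonal (e ∷ es) x
    with joins (toℕ (lo e)) (toℕ (hi e)) x x | joins-test (toℕ (lo e)) (toℕ (hi e)) x x
  ... | _ | false _                  = lookup-diagonal es x
  ... | _ | true (inj₁ (refl , eq)) = contradiction (ordered e) (<-irrefl (sym eq))
  ... | _ | true (inj₂ (refl , eq)) = contradiction (ordered e) (<-irrefl (sym eq))

  lookup-range : ∀ es x y → lookup (map triple es) x y ≤ n ∸ 1
  lookup-range []       x y = z≤n
  lookup-range (e ∷ es) x y with joins (toℕ (lo e)) (toℕ (hi e)) x y
  ... | zero  = lookup-range es x y
  ... | suc _ = Fin.toℕ<n (C e)

  -- The first triple that matches the ends of e must come from e: the increasing order rules out a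
  -- reversed match, and two edges with the same ends are equal because the proof of their order is
  -- irrelevant.
  lookup-∈ : ∀ {e es} → e ∈ es → lookup (map triple es) (toℕ (lo e)) (toℕ (hi e)) ≡ suc (toℕ (C e))
  lookup-∈ {e} {f ∷ es} e∈
    with joins (toℕ (lo f)) (toℕ (hi f)) (toℕ (lo e)) (toℕ (hi e))
       | joins-test (toℕ (lo f)) (toℕ (hi f)) (toℕ (lo e)) (toℕ (hi e)) | e∈
  ... | _ | true (inj₂ (lo≡hi , hi≡lo)) | _ =
    contradiction (ordered f) (<-asym (subst₂ _<_ (sym hi≡lo) (sym lo≡hi) (ordered e)))
  ... | _ | false ¬j | here refl = contradiction (inj₁ (refl , refl)) ¬j
  ... | _ | false _  | there e∈′ = lookup-∈ e∈′
  ... | _ | true (inj₁ (lo≡ , hi≡)) | _ with Fin.toℕ-injective lo≡ | Fin.toℕ-injective hi≡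
  ...   | refl | refl = refl

  matrix-edge : ∀ e → matrix C (toℕ (lo e)) (toℕ (hi e)) ≡ suc (toℕ (C e))
  matrix-edge e = lookup-∈ (∈-edges e)

  matrix-edgeColouring : EdgeColouring n (matrix C)
  matrix-edgeColouring = record
    { symmetric = lookup-sym (triples C)
    ; diagonal  = lookup-diagonal (edges n)
    ; positive  = positive
    ; range     = lookup-range (edges n)
    }
    where
    positive : ∀ {x y} → x < n → y < n → x ≢ y → 0 < matrix C x y
    positive x<n y<n x≢y with edge-between x<n y<n x≢y
    ... | e , inj₁ (refl , refl) = subst (0 <_) (sym (matrix-edge e)) z<s
    ... | e , inj₂ (refl , refl) =
      subst (0 <_) (sym (trans (lookup-sym (triples C) (toℕ (hi e)) (toℕ (lo e))) (matrix-edge e))) z<s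

  -- Both matrices are symmetric and vanish on the diagonal, so agreement on pairs in increasing
  -- order is enough.
  matrix-unique : ∀ {c} → EdgeColouring n c → (∀ e → suc (toℕ (C e)) ≡ c (toℕ (lo e)) (toℕ (hi e))) →
                  ∀ x y → x < n → y < n → matrix C x y ≡ c x y
  matrix-unique {c} col eq x y x<n y<n with x ≟ y
  ... | yes refl = trans (lookup-diagonal (edges n) x) (sym (EdgeColouring.diagonal col x))
  ... | no  x≢y with edge-between x<n y<n x≢y
  ...   | e , inj₁ (refl , refl) = trans (matrix-edge e) (eq e)
  ...   | e , inj₂ (refl , refl) = trans (lookup-sym (triples C) (toℕ (hi e)) (toℕ (lo e)))
    (trans (matrix-edge e) (trans (eq e) (EdgeColouring.symmetric col (toℕ (lo e)) (toℕ (hi e)))))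

  small-triples : ∀ {N} → n ≤ N → n * n ≤ N → Small N (triples C)
  small-triples n≤N n²≤N = record
    { length≤ = ≤-trans (≤-reflexive (length-map triple (edges n))) (≤-trans (length-edges n) n²≤N)
    ; entries = All.map⁺ (All.universal (λ e →
        ≤-trans (<⇒≤ (Fin.toℕ<n (lo e))) n≤N , ≤-trans (<⇒≤ (Fin.toℕ<n (hi e))) n≤N ,
        ≤-trans (Fin.toℕ<n (C e)) (≤-trans (m∸n≤m n 1) n≤N)) (edges n))
    }

module _ {c : ℕ → ℕ → ℕ} (col : EdgeColouring n c) where

  private
    matrix-colour< : ∀ e → c (toℕ (lo e)) (toℕ (hi e)) ∸ 1 < n ∸ 1
    matrix-colour< e = <-≤-trans
      (pred< (EdgeColouring.positive col (Fin.toℕ<n (lo e)) (Fin.toℕ<n (hi e)) (<⇒≢ (ordered e))))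
      (EdgeColouring.range col _ _)
      where
      pred< : ∀ {k} → 0 < k → k ∸ 1 < k
      pred< {suc k} _ = ≤-refl

  decode : Coloring n
  decode e = fromℕ< (matrix-colour< e)

  toℕ-decode : ∀ e → toℕ (decode e) ≡ c (toℕ (lo e)) (toℕ (hi e)) ∸ 1
  toℕ-decode e = Fin.toℕ-fromℕ< (matrix-colour< e)

  suc-decode : ∀ e → suc (toℕ (decode e)) ≡ c (toℕ (lo e)) (toℕ (hi e))
  suc-decode e = trans (cong suc (toℕ-decode e))
    (m+[n∸m]≡n (EdgeColouring.positive col (Fin.toℕ<n (lo e)) (Fin.toℕ<n (hi e)) (<⇒≢ (ordered e))))

  matrix-decode : ∀ x y → x < n → y < n → matrix decode x y ≡ c x y
  matrix-decode = matrix-unique decode col suc-decode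

-- Counting edges by their end points

∑-head : ∀ n f → ∑ (suc n) f ≡ f 0 + ∑ n (f ∘ suc)
∑-head zero    f = +-comm 0 (f 0)
∑-head (suc n) f rewrite ∑-head n f = +-assoc (f 0) _ _

sum-tabulate : ∀ {A : Set} n (h : Fin n → A) f g → (∀ i → f (h i) ≡ g (toℕ i)) → sum (map f (tabulate h)) ≡ ∑ n g
sum-tabulate zero    h f g eq = refl
sum-tabulate (suc n) h f g eq =
  trans (cong₂ _+_ (eq Fin.zero) (sum-tabulate n (h ∘ Fin.suc) f (g ∘ suc) (eq ∘ Fin.suc))) (sym (∑-head n g))

sum-cartesianProduct : ∀ {A B : Set} (f : A × B → ℕ) xs ys →
  sum (map f (cartesianProduct xs ys)) ≡ sum (map (λ x → sum (map (λ y → f (x , y)) ys)) xs)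
sum-cartesianProduct f []       ys = refl
sum-cartesianProduct f (x ∷ xs) ys = begin
  sum (map f (map (x ,_) ys ++ cartesianProduct xs ys))
    ≡⟨ cong sum (map-++ f (map (x ,_) ys) _) ⟩
  sum (map f (map (x ,_) ys) ++ map f (cartesianProduct xs ys))
    ≡⟨ sum-++ (map f (map (x ,_) ys)) _ ⟩
  sum (map f (map (x ,_) ys)) + sum (map f (cartesianProduct xs ys))
    ≡⟨ cong₂ _+_ (cong sum (sym (map-∘ ys))) (sum-cartesianProduct f xs ys) ⟩
  sum (map (λ y → f (x , y)) ys) + sum (map (λ x → sum (map (λ y → f (x , y)) ys)) xs)
    ∎
  where open ≡-Reasoning

indicator : ∀ {P : Set} → Dec P → ℕ
indicator (yes _) = 1
indicator (no _)  = 0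

indicator-test : ∀ {P : Set} (P? : Dec P) → Test P (indicator P?)
indicator-test (yes p) = true p
indicator-test (no ¬p) = false ¬p

length-filter-mapMaybe : ∀ {A : Set} {P : Edge n → Set} (P? : ∀ e → Dec (P e)) (f : A → _) xs (g : A → ℕ) →
  (∀ x → f x ≡ nothing → g x ≡ 0) → (∀ x e → f x ≡ just e → g x ≡ indicator (P? e)) →
  length (filter P? (mapMaybe f xs)) ≡ sum (map g xs)
length-filter-mapMaybe P? f []       g none some = refl
length-filter-mapMaybe P? f (x ∷ xs) g none some with f x in eq
... | nothing rewrite none x eq = length-filter-mapMaybe P? f xs g none some
... | just e  rewrite some x e eq with P? e
...   | yes _ = cong suc (length-filter-mapMaybe P? f xs g none some)
...   | no  _ = length-filter-mapMaybe P? f xs g none some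

+-test : ∀ {P Q : Set} {i j} → ¬ (P × Q) → Test P i → Test Q j → Test (P ⊎ Q) (i + j)
+-test ¬pq (true p)   (true q)   = contradiction (p , q) ¬pq
+-test _   (true p)   (false _)  = true (inj₁ p)
+-test _   (false _)  (true q)   = true (inj₂ q)
+-test _   (false ¬p) (false ¬q) = false λ { (inj₁ p) → ¬p p ; (inj₂ q) → ¬q q }

*-test : ∀ {P Q : Set} {i j} → Test P i → Test Q j → Test (P × Q) (i * j)
*-test (true p)   (true q)   = true (p , q)
*-test (true _)   (false ¬q) = false (¬q ∘ proj₂)
*-test (false ¬p) _          = false (¬p ∘ proj₁)

-- Every vertex other than u forms exactly one increasing pair with u, in which u is either the
-- smaller or the larger end. The two resulting sums complement each other.
∑-ordered-pairs : ∀ n (h : ℕ → ℕ → ℕ) {u} → u < n → (∀ x y → h x y ≡ h y x) → (∀ x → h x x ≡ 0) →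
  ∑ n (λ x → ∑ n (λ y → indicator (x <? y) * ((δ x u + δ y u) * h x y))) ≡ ∑ n (h u)
∑-ordered-pairs n h {u} u<n h-sym h-diag = begin
  ∑ n (λ x → ∑ n (λ y → lt x y * ((δ x u + δ y u) * h x y)))
    ≡⟨ ∑-cong n (λ x _ → trans (∑-cong n (λ y _ → expand (lt x y) (δ x u) (δ y u) (h x y))) (∑-distrib-+ n _ _)) ⟩
  ∑ n (λ x → ∑ n (λ y → δ x u * (lt x y * h x y)) + ∑ n (λ y → δ y u * (lt x y * h x y)))
    ≡⟨ ∑-distrib-+ n _ _ ⟩
  ∑ n (λ x → ∑ n (λ y → δ x u * (lt x y * h x y))) + ∑ n (λ x → ∑ n (λ y → δ y u * (lt x y * h x y)))
    ≡⟨ cong₂ _+_ (trans (∑-swap n n _) (∑-cong n λ y _ → ∑-δ n (λ x → lt x y * h x y) u<n))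
                 (∑-cong n λ x _ → ∑-δ n (λ y → lt x y * h x y) u<n) ⟩
  ∑ n (λ y → lt u y * h u y) + ∑ n (λ x → lt x u * h x u)
    ≡⟨ ∑-distrib-+ n _ _ ⟨
  ∑ n (λ x → lt u x * h u x + lt x u * h x u)
    ≡⟨ ∑-cong n (λ x _ → merge x) ⟩
  ∑ n (h u)
    ∎
  where
  open ≡-Reasoning
  lt : ℕ → ℕ → ℕ
  lt x y = indicator (x <? y)
  expand : ∀ l a b k → l * ((a + b) * k) ≡ a * (l * k) + b * (l * k)
  expand = solve-∀
  merge : ∀ x → lt u x * h u x + lt x u * h x u ≡ h u x
  merge x with u <? x | x <? u
  ... | yes u<x | yes x<u = contradiction x<u (<-asym u<x)
  ... | yes _   | no  _   = trans (+-identityʳ _) (+-identityʳ _)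
  ... | no  _   | yes _   = trans (+-identityʳ _) (h-sym x u)
  ... | no  u≮x | no  x≮u with ≤-antisym (≮⇒≥ x≮u) (≮⇒≥ u≮x)
  ...   | refl = sym (h-diag u)

choose-2 : ∀ k → k choose 2 ≡ tri k
choose-2 zero    = refl
choose-2 (suc k) = begin
  suc k choose 2              ≡⟨ nCk+nC[k+1]≡[n+1]C[k+1] k 1 ⟨
  k choose 1 + k choose 2     ≡⟨ cong₂ _+_ (nC1≡n k) (choose-2 k) ⟩
  k + tri k                   ≡⟨ +-comm k (tri k) ⟩
  tri k + k                   ∎
  where open ≡-Reasoning

multiplicity-count : ∀ (C : Coloring n) u μ → multiplicity C u μ ≡ count n (matrix C (toℕ u)) (suc (toℕ μ))
multiplicity-count {n} C u μ = begin
  multiplicity C u μ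
    ≡⟨ length-filter-mapMaybe _ mkEdge (cartesianProduct (allFin n) (allFin n)) g none some ⟩
  sum (map g (cartesianProduct (allFin n) (allFin n)))
    ≡⟨ sum-cartesianProduct g (allFin n) (allFin n) ⟩
  sum (map (λ x → sum (map (λ y → g (x , y)) (allFin n))) (allFin n))
    ≡⟨ sum-tabulate n id _ _ (λ x → sum-tabulate n id (λ y → g (x , y)) (G (toℕ x)) (λ _ → refl)) ⟩
  ∑ n (λ x → ∑ n (G x))
    ≡⟨ ∑-ordered-pairs n h (Fin.toℕ<n u) (λ x y → cong (λ k → δ k (suc (toℕ μ))) (symmetric x y))
                       (λ x → cong (λ k → δ k (suc (toℕ μ))) (diagonal x)) ⟩
  count n (matrix C (toℕ u)) (suc (toℕ μ))
    ∎
  where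
  open ≡-Reasoning
  open EdgeColouring (matrix-edgeColouring C)
  h : ℕ → ℕ → ℕ
  h x y = δ (matrix C x y) (suc (toℕ μ))
  G : ℕ → ℕ → ℕ
  G x y = indicator (x <? y) * ((δ x (toℕ u) + δ y (toℕ u)) * h x y)
  g : Fin n × Fin n → ℕ
  g (x , y) = G (toℕ x) (toℕ y)
  none : ∀ p → mkEdge p ≡ nothing → g p ≡ 0
  none (x , y) eq with x Fin.<? y
  ... | no  x≮y with toℕ x <? toℕ y
  ...   | no _    = refl
  ...   | yes x<y = contradiction x<y x≮y
  fin-δ-test : (x y : Fin n) → Test (y ≡ x) (δ (toℕ x) (toℕ y))
  fin-δ-test x y =
    test-map (λ eq → Fin.toℕ-injective (sym eq)) (λ eq → cong toℕ (sym eq)) (δ-test (toℕ x) (toℕ y))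
  some : ∀ p e → mkEdge p ≡ just e → g p ≡ indicator (incident? u e ×-dec (C e Fin.≟ μ))
  some (x , y) e eq with x Fin.<? y
  some (x , y) .(edge x y _) refl | yes x<y with toℕ x <? toℕ y
  ... | no x≮y = contradiction x<y x≮y
  -- Since x < y, the vertex u cannot be both ends, so the sum of the two deltas is again a truth
  -- value and decides incidence.
  ... | yes _  = trans (+-identityʳ _) (test-unique
    (*-test (+-test (λ (u≡x , u≡y) → <⇒≢ x<y (cong toℕ (trans (sym u≡x) u≡y))) (fin-δ-test x u) (fin-δ-test y u))
            (test-map (λ eq → Fin.toℕ-injective (suc-injective (trans (sym (matrix-edge C e′)) eq)))
                      (λ eq → trans (matrix-edge C e′) (cong (suc ∘ toℕ) eq))
                      (δ-test (matrix C (toℕ x) (toℕ y)) (suc (toℕ μ)))))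
    (indicator-test (incident? u e′ ×-dec (C e′ Fin.≟ μ))))
    where
    e′ : Edge n
    e′ = edge x y x<y

Ψ-matrixΨ : (C : Coloring n) → Ψ C ≡ matrixΨ n (matrix C)
Ψ-matrixΨ {n} C = sum-tabulate n id _ (λ u → rowΨ n (matrix C u)) λ u →
  sum-tabulate (n ∸ 1) id _ (λ μ → tri (count n (matrix C (toℕ u)) (suc μ))) λ μ →
    trans (choose-2 (multiplicity C u μ)) (cong tri (multiplicity-count C u μ))

-- Repeated colours and one-factorizations

OtherEnd : Fin n → Edge n → Fin n → Set
OtherEnd u e x = (u ≡ lo e × x ≡ hi e) ⊎ (u ≡ hi e × x ≡ lo e)

other-end : ∀ {u : Fin n} e → Incident u e → ∃[ x ] OtherEnd u e x
other-end e (inj₁ u≡lo) = hi e , inj₁ (u≡lo , refl)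
other-end e (inj₂ u≡hi) = lo e , inj₂ (u≡hi , refl)

other-end-injective : ∀ {u x : Fin n} e f → OtherEnd u e x → OtherEnd u f x → e ≡ f
other-end-injective (edge a b _) (edge a′ b′ _) (inj₁ (refl , refl)) (inj₁ (refl , refl)) = refl
other-end-injective (edge a b _) (edge a′ b′ _) (inj₂ (refl , refl)) (inj₂ (refl , refl)) = refl
other-end-injective e@(edge a b _) f@(edge a′ b′ _) (inj₁ (refl , refl)) (inj₂ (refl , refl)) =
  contradiction (ordered e) (<-asym (ordered f))
other-end-injective e@(edge a b _) f@(edge a′ b′ _) (inj₂ (refl , refl)) (inj₁ (refl , refl)) =
  contradiction (ordered e) (<-asym (ordered f))

matrix-other-end : ∀ (C : Coloring n) {u x} e → OtherEnd u e x → matrix C (toℕ u) (toℕ x) ≡ suc (toℕ (C e))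
matrix-other-end C e (inj₁ (refl , refl)) = matrix-edge C e
matrix-other-end C e (inj₂ (refl , refl)) =
  trans (lookup-sym (triples C) (toℕ (hi e)) (toℕ (lo e))) (matrix-edge C e)

Repeated : Coloring n → Set
Repeated {n} C = ∃[ v ] v < n × ∃[ μ ] μ < n ∸ 1 × 2 ≤ count n (matrix C v) (suc μ)

repeated? : (C : Coloring n) → Dec (Repeated C)
repeated? {n} C = anyUpTo? (λ v → anyUpTo? (λ μ → 2 ≤? count n (matrix C v) (suc μ)) (n ∸ 1)) n

-- Distinct edges at u have distinct other ends, so two of the same colour yield two entries of that
-- colour in row u.
¬repeated⇒oneFactorization : (C : Coloring n) → ¬ Repeated C → OneFactorization C
¬repeated⇒oneFactorization {n} C none e f e≢f (u , u∈e , u∈f) Ce≡Cf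
  with other-end e u∈e | other-end f u∈f
... | x , end-x | y , end-y = none (toℕ u , Fin.toℕ<n u , toℕ (C e) , Fin.toℕ<n (C e) , (begin
  2                                          ≡⟨ cong₂ _+_ (hit e end-x refl) (hit f end-y (sym Ce≡Cf)) ⟨
  h (toℕ x) + h (toℕ y)                      ≤⟨ two-terms≤∑ n h (Fin.toℕ<n x) (Fin.toℕ<n y) x≢y ⟩
  count n (matrix C (toℕ u)) (suc (toℕ (C e))) ∎))
  where
  open ≤-Reasoning
  h : ℕ → ℕ
  h z = δ (matrix C (toℕ u) z) (suc (toℕ (C e)))
  hit : ∀ {z} g → OtherEnd u g z → C g ≡ C e → h (toℕ z) ≡ 1
  hit g end eq = trans (cong (λ k → δ k (suc (toℕ (C e)))) (trans (matrix-other-end C g end) (cong (suc ∘ toℕ) eq)))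
                       (δ-refl (toℕ (C e)))
  x≢y : toℕ x ≢ toℕ y
  x≢y eq with Fin.toℕ-injective eq
  ... | refl = e≢f (other-end-injective e f end-x end-y)

-- Adjacency

-- Adjacency without its two inequalities, so that it covers the candidates with u = w and those
-- that change nothing.
Near : Coloring n → Coloring n → Set
Near C C′ = ∃[ u ] ∃[ v ] (∀ e → C e ≢ C′ e → Incident u e ⊎ Incident v e)

-- Pointwise equal colourings have the same list of triples, and Ψ can be computed from that list.
Ψ-cong : {C C′ : Coloring n} → (∀ e → C e ≡ C′ e) → Ψ C ≡ Ψ C′
Ψ-cong {n} {C} {C′} eq = begin
  Ψ C                       ≡⟨ Ψ-matrixΨ C ⟩
  matrixΨ n (matrix C)      ≡⟨ cong (matrixΨ n ∘ lookup) (map-cong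
    (λ e → cong (λ k → toℕ (lo e) , toℕ (hi e) , toℕ k) (eq e)) (edges n)) ⟩
  matrixΨ n (matrix C′)     ≡⟨ Ψ-matrixΨ C′ ⟨
  Ψ C′                      ∎
  where open ≡-Reasoning

-- A strict decrease of Ψ forces some edge e to change. If the two centres coincide, an end of e
-- different from that centre serves as the second one.
near-adjacent : {C C′ : Coloring n} → Near C C′ → Ψ C′ < Ψ C → Adjacent C C′
near-adjacent {n} {C} {C′} (u , v , near) Ψ< with any? (λ e → ¬? (C e Fin.≟ C′ e)) (edges n)
... | no  none = contradiction (Ψ-cong same) (<⇒≢ Ψ< ∘ sym)
  where
  same : ∀ e → C e ≡ C′ e
  same e with C e Fin.≟ C′ e
  ... | yes eq = eq
  ... | no  changed = contradiction (Any.map (λ { refl → changed }) (∈-edges e)) none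
... | yes some with find some | u Fin.≟ v
...   | e , _ , changed | no  u≢v  = (e , changed) , u , v , u≢v , near
...   | e , _ , changed | yes refl with u Fin.≟ lo e
...     | no  u≢lo = (e , changed) , u , lo e , u≢lo , λ f → inj₁ ∘ reduce ∘ near f
...     | yes refl = (e , changed) , u , hi e , (λ eq → <⇒≢ (ordered e) (cong toℕ eq)) ,
  λ f → inj₁ ∘ reduce ∘ near f

-- Candidates as colourings

module _ (C : Coloring n) (v : ℕ) {w u ν : ℕ} (w<n : w < n) (u<n : u < n) (ν< : ν < n ∸ 1) where

  private
    col : EdgeColouring n (candidate n (matrix C) v w u ν)
    col = candidate-edgeColouring v (matrix-edgeColouring C) w<n u<n ν<

  moved : Coloring n
  moved = decode col

  moved-triples : move n (triples C) v w u ν ≡ triples moved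
  moved-triples = trans (sym (map-∘ (edges n)))
    (map-cong (λ e → cong (λ k → toℕ (lo e) , toℕ (hi e) , k) (sym (toℕ-decode col e))) (edges n))

  moved-near : Near C moved
  moved-near = fromℕ< w<n , fromℕ< u<n , near
    where
    near : ∀ e → C e ≢ moved e → Incident (fromℕ< w<n) e ⊎ Incident (fromℕ< u<n) e
    near e changed with incident? (fromℕ< w<n) e | incident? (fromℕ< u<n) e
    ... | yes w∈e | _       = inj₁ w∈e
    ... | no  _   | yes u∈e = inj₂ u∈e
    ... | no  w∉e | no  u∉e = contradiction (Fin.toℕ-injective (suc-injective (begin
      suc (toℕ (C e))                                            ≡⟨ matrix-edge C e ⟨
      matrix C (toℕ (lo e)) (toℕ (hi e))                         ≡⟨ recolour-≡ (matrix C) v w ν _ _ (λ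
        { (inj₁ (_ , w≡hi)) → contradiction (sym w≡hi) (away w<n (hi e) (w∉e ∘ inj₂))
        ; (inj₂ (_ , w≡lo)) → contradiction (sym w≡lo) (away w<n (lo e) (w∉e ∘ inj₁)) }) ⟨
      recolour (matrix C) v w ν (toℕ (lo e)) (toℕ (hi e))        ≡⟨ exchange-unmoved (recolour (matrix C) v w ν)
        {F = proj₂ (Walk.walk n (recolour (matrix C) v w ν) w u (suc ν))}
        (away w<n (lo e) (w∉e ∘ inj₁)) (away u<n (lo e) (u∉e ∘ inj₁))
        (away w<n (hi e) (w∉e ∘ inj₂)) (away u<n (hi e) (u∉e ∘ inj₂)) ⟨
      candidate n (matrix C) v w u ν (toℕ (lo e)) (toℕ (hi e))   ≡⟨ suc-decode col e ⟨
      suc (toℕ (moved e))                                        ∎))) changed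
      where
      open ≡-Reasoning
      away : ∀ {z} (z<n : z < n) i → fromℕ< z<n ≢ i → toℕ i ≢ z
      away z<n i z≢i refl = z≢i (Fin.fromℕ<-toℕ i z<n)

  moved-Ψ : matrixΨ n (lookup (move n (triples C) v w u ν)) ≡ matrixΨ n (candidate n (matrix C) v w u ν)
  moved-Ψ = trans (cong (matrixΨ n ∘ lookup) moved-triples) (matrixΨ-cong n (matrix-decode col))

-- Correctness of the search

attempt-Ψ : ∀ n L v w u ν B → let Ψ′ = λ B → matrixΨ n (lookup B) in
  Ψ′ (attempt n L v w u ν B) ≤ Ψ′ B × Ψ′ (attempt n L v w u ν B) ≤ Ψ′ (move n L v w u ν)
attempt-Ψ n L v w u ν B
  with matrixΨ n (lookup B) ∸ matrixΨ n (lookup (move n L v w u ν)) in eq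
... | zero  = ≤-refl , m∸n≡0⇒m≤n eq
... | suc k = <⇒≤ (m∸n≢0⇒n<m λ eq′ → 0≢1+n (trans (sym eq′) eq)) , ≤-refl

loop-invariant : ∀ {B : Set} (I : B → Set) {s : B → ℕ → B} → ∀ n → (∀ m r → m < n → I r → I (s r m)) →
                 ∀ {z} → I z → I (primℕ z s n)
loop-invariant I zero    preserve Iz = Iz
loop-invariant I (suc n) preserve Iz =
  preserve n _ ≤-refl (loop-invariant I n (λ m r m<n → preserve m r (m<n⇒m<1+n m<n)) Iz)

-- Step j establishes `Q` whatever happened before it, and the later steps keep it. This is applied
-- at each of the four nested loops to the index of the improving candidate.
loop-reaches : ∀ {B : Set} (Q : B → Set) {s : B → ℕ → B} → ∀ {j} n → j < n →
               (∀ m r → m < n → Q r → Q (s r m)) → (∀ r → Q (s r j)) → ∀ z → Q (primℕ z s n)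
loop-reaches Q {j = j} (suc n) j<1+n preserve reach z with j ≟ n
... | yes refl = reach _
... | no  j≢n  = preserve n _ ≤-refl
  (loop-reaches Q n (≤∧≢⇒< (s≤s⁻¹ j<1+n) j≢n) (λ m r m<n → preserve m r (m<n⇒m<1+n m<n)) reach z)

module _ (C : Coloring n) where

  Reachable : List (ℕ × ℕ × ℕ) → Set
  Reachable B = ∃[ C′ ] B ≡ triples C′ × Near C C′

  search-reachable : 0 < n → Reachable (search n (triples C))
  search-reachable 0<n =
    loop-invariant Reachable n (λ v B _ →
      loop-invariant Reachable n λ w B w<n →
        loop-invariant Reachable n λ u B u<n →
          loop-invariant Reachable (n ∸ 1) λ ν B ν< reachable →
            attempt-preserves Reachable n (triples C) v w u ν reachable
              (moved C v w<n u<n ν< , moved-triples C v w<n u<n ν< , moved-near C v w<n u<n ν<))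
      (C , refl , fromℕ< 0<n , fromℕ< 0<n , λ e changed → contradiction refl changed)

  search-decreases : Improving (matrix-edgeColouring C) →
                     matrixΨ n (lookup (search n (triples C))) < matrixΨ n (matrix C)
  search-decreases (v , w , u , ν , v<n , w<n , u<n , ν< , Ψ<) =
    loop-reaches Better n v<n (λ v _ _ → w-loop v)
      (loop-reaches Better n w<n (λ w _ _ → u-loop v w)
        (loop-reaches Better n u<n (λ u _ _ → ν-loop v w u)
          (loop-reaches Better (n ∸ 1) ν< (λ ν _ _ → attempt-better v w u ν)
            λ B → ≤-<-trans (proj₂ (attempt-Ψ n (triples C) v w u ν B))
                            (subst (_< matrixΨ n (matrix C)) (sym (moved-Ψ C v w<n u<n ν<)) Ψ<))))
      (triples C)
    where
    Better : List (ℕ × ℕ × ℕ) → Set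
    Better B = matrixΨ n (lookup B) < matrixΨ n (matrix C)
    attempt-better : ∀ v w u ν {B} → Better B → Better (attempt n (triples C) v w u ν B)
    attempt-better v w u ν {B} = ≤-<-trans (proj₁ (attempt-Ψ n (triples C) v w u ν B))
    ν-loop : ∀ v w u {B} → Better B → Better (primℕ B (λ B ν → attempt n (triples C) v w u ν B) (n ∸ 1))
    ν-loop v w u = loop-invariant Better (n ∸ 1) λ ν _ _ → attempt-better v w u ν
    u-loop : ∀ v w {B} → Better B →
             Better (primℕ B (λ B u → primℕ B (λ B ν → attempt n (triples C) v w u ν B) (n ∸ 1)) n)
    u-loop v w = loop-invariant Better n λ u _ _ → ν-loop v w u
    w-loop : ∀ v {B} → Better B →
             Better (primℕ B (λ B w → primℕ B (λ B u → primℕ B (λ B ν → attempt n (triples C) v w u ν B) (n ∸ 1)) n) n)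
    w-loop v = loop-invariant Better n λ w _ _ → u-loop v w

  search-improves : 2 ∣ n → Repeated C →
    ∃[ C′ ] run searchP (encode C) ≡ encode C′ × Adjacent C C′ × Ψ C′ < Ψ C
  search-improves 2∣n (v , v<n , μ , μ< , repeated) = improved (run-searchP n (triples C))
    (search-reachable (≤-<-trans z≤n v<n))
    (search-decreases (improving (matrix-edgeColouring C) 2∣n v<n μ< repeated))
    where
    improved : ∀ {B} → run searchP (encode C) ≡ (n , B) → Reachable B → matrixΨ n (lookup B) < matrixΨ n (matrix C) →
               ∃[ C′ ] run searchP (encode C) ≡ encode C′ × Adjacent C C′ × Ψ C′ < Ψ C
    improved eq (C′ , refl , near) Ψ< = C′ , eq , near-adjacent near Ψ<′ , Ψ<′
      where
      Ψ<′ : Ψ C′ < Ψ C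
      Ψ<′ = subst₂ _<_ (sym (Ψ-matrixΨ C′)) (sym (Ψ-matrixΨ C)) Ψ<

-- The descending walk and the running time

Ψ≤n³ : (C : Coloring n) → Ψ C ≤ n ^ 3
Ψ≤n³ {n} C = begin
  Ψ C                      ≡⟨ Ψ-matrixΨ C ⟩
  matrixΨ n (matrix C)     ≤⟨ matrixΨ≤ n (matrix C) ⟩
  n * (n * n)              ≡⟨ cong (λ k → n * (n * k)) (*-identityʳ n) ⟨
  n ^ 3                    ∎
  where open ≤-Reasoning

-- Each step lowers Ψ by at least 1, so a bound k on Ψ is at once the termination measure and the
-- bound on the length.
descend : 2 ∣ n → ∀ k (C : Coloring n) → Ψ C ≤ k →
          ∃[ F ] ∃[ ℓ ] DescendingWalk C F ℓ × OneFactorization F × ℓ ≤ k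
descend {n} 2∣n k C Ψ≤k = split k Ψ≤k (repeated? C)
  where
  Result : Coloring n → ℕ → Set
  Result C k = ∃[ F ] ∃[ ℓ ] DescendingWalk C F ℓ × OneFactorization F × ℓ ≤ k
  extend : ∀ {C C′ k} → Adjacent C C′ → Ψ C′ < Ψ C → Result C′ k → Result C (suc k)
  extend adj Ψ< (F , ℓ , walk , oneF , ℓ≤k) = F , suc ℓ , step adj Ψ< walk , oneF , s≤s ℓ≤k
  split : ∀ k → Ψ C ≤ k → Dec (Repeated C) → Result C k
  split k       Ψ≤k (no none)  = C , 0 , stop , ¬repeated⇒oneFactorization C none , z≤n
  split zero    Ψ≤k (yes rep) = let _ , _ , _ , Ψ< = search-improves C 2∣n rep in
    contradiction (<-≤-trans Ψ< Ψ≤k) λ ()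
  split (suc k) Ψ≤k (yes rep) = let C′ , _ , adj , Ψ< = search-improves C 2∣n rep in
    extend adj Ψ< (descend 2∣n k C′ (s≤s⁻¹ (<-≤-trans Ψ< Ψ≤k)))

search-time : ∃[ k ] ∃[ d ] (∀ {n} (C : Coloring n) → 0 < n →
              time {coloringTy} {coloringTy} searchP (encode C) ≤ k * n ^ d)
search-time with staticCost-polynomial searchP
-- All recursions are bounded by N = n³, so degree d in N becomes degree `3 * d` in n.
... | k , d , cost≤k*N^d = k , 3 * d , bound
  where
  bound : ∀ {n} (C : Coloring n) → 0 < n → time {coloringTy} {coloringTy} searchP (encode C) ≤ k * n ^ (3 * d)
  bound {n} C 0<n = begin
    time {coloringTy} {coloringTy} searchP (encode C)
      ≤⟨ cost≤ searchP (encode C ∷ []) (ok-searchP n≤n³ n²≤n³ n³≤n³ small (matrix-edgeColouring C) λ {v} _ w<n u<n ν< →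
           subst (Small (n ^ 3)) (sym (moved-triples C v w<n u<n ν<)) (small-triples (moved C v w<n u<n ν<) n≤n³ n²≤n³)) ⟩
    staticCost (n ^ 3) searchP
      ≤⟨ cost≤k*N^d (n ^ 3) (≤-trans 0<n n≤n³) ⟩
    k * (n ^ 3) ^ d
      ≡⟨ cong (k *_) (^-*-assoc n 3 d) ⟩
    k * n ^ (3 * d)
      ∎
    where
    open ≤-Reasoning
    instance _ = >-nonZero 0<n
    n≤n³ : n ≤ n ^ 3
    n≤n³ = subst (_≤ n ^ 3) (^-identityʳ n) (^-monoʳ-≤ n {1} {3} (s≤s z≤n))
    n²≤n³ : n * n ≤ n ^ 3
    n²≤n³ = subst (_≤ n ^ 3) (cong (n *_) (*-identityʳ n)) (^-monoʳ-≤ n {2} {3} (s≤s (s≤s z≤n)))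
    n³≤n³ : n * (n * n) ≤ n ^ 3
    n³≤n³ = ≤-reflexive (cong (λ k → n * (n * k)) (sym (*-identityʳ n)))
    small : Small (n ^ 3) (triples C)
    small = small-triples C n≤n³ n²≤n³

theorem2 :
    (∀ n → 2 ∣ n → (C : Coloring n) → ¬ OneFactorization C →
       ∃[ C′ ] Adjacent C C′ × Ψ C′ < Ψ C)
    ×
    (∃[ p ] ∃[ c ] ∃[ d ]
       (∀ n → 2 ∣ n → (C : Coloring n) → ¬ OneFactorization C →
          time {coloringTy} {coloringTy} p (encode C) ≤ c * n ^ d ×
          (∃[ C′ ] run p (encode C) ≡ encode C′ × Adjacent C C′ × Ψ C′ < Ψ C)))
    ×
    (∃[ K ]
       (∀ n → 2 ∣ n → (C : Coloring n) →
          ∃[ F ] ∃[ ℓ ] DescendingWalk C F ℓ × OneFactorization F × ℓ ≤ K * n ^ 3))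
theorem2 =
  (λ n 2∣n C ¬oneF → map₂ proj₂ (search-improves C 2∣n (repetition C ¬oneF))) ,
  (searchP , map₂ (map₂ λ time≤ n 2∣n C ¬oneF →
    -- The vertex with a repeated colour shows that n is positive.
    time≤ C (≤-<-trans z≤n (proj₁ (proj₂ (repetition C ¬oneF)))) ,
    search-improves C 2∣n (repetition C ¬oneF)) search-time) ,
  (1 , λ n 2∣n C → descend 2∣n (1 * n ^ 3) C (subst (Ψ C ≤_) (sym (*-identityˡ (n ^ 3))) (Ψ≤n³ C)))
  where
  repetition : ∀ {n} (C : Coloring n) → ¬ OneFactorization C → Repeated C
  repetition C ¬oneF = decidable-stable (repeated? C) (¬oneF ∘ ¬repeated⇒oneFactorization C)
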